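{- Let $(\mathcal R,\exp)$ be an exponential field which is a model of $\mathsf{MaxVal}(\exp)$ and satisfies $\exp(1)=2$. Let $\mathcal M\subseteq\mathcal R$ be a discretely ordered ring such that $(\mathcal M,\exp)$ is an exponential integer part of $(\mathcal R,\exp)$. Then $(\mathcal M^+,\exp|_{M^+})$, with $S(x)$ interpreted as $x+1$, is a model of $\mathsf{IOpen}(\exp)$.
   Context: An exponential field is an ordered field $\mathcal F$ with a map $\exp\colon F\to F^{>0}$ that is an order-preserving isomorphism from $(F,+)$ onto $(F^{>0},\cdot)$. $\mathsf{MaxVal}(\exp)$ is the scheme consisting, for every term $t(x,\bar w)$ of the language $\mathcal L_{OR}(\exp)=(+,\cdot,0,1,\leqslant,\exp)$, of the sentence $\forall\bar w\,\forall x,y\,\big(x<y\to\exists z_{\max}\in[x,y]\,\forall z\in[x,y]\;t(z,\bar w)\leqslant t(z_{\max},\bar w)\big)$. A discretely ordered ring is an ordered (commutative unital) ring in which $1$ is the least positive element; $M^+=\{m\in M:m\geqslant0\}$. If $\mathcal M\subseteq\mathcal R$ with $\mathcal M$ discretely ordered, $\mathcal M$ is an integer part of $\mathcal R$ if for each $r\in R$ there is $m\in M$ with $m\leqslant r<m+1$; $(\mathcal M,\exp)$ is an exponential integer part of $(\mathcal R,\exp)$ if moreover $\exp(m)\in M^+$ for all $m\in M^+$. The theory $\mathsf{IOpen}(\exp)$ in the language $(0,S,+,\cdot,\leqslant,\exp)$ consists of: (Q1) $Sx\neq0$; (Q2) $Sx=Sy\to x=y$; (Q3) $x\neq0\to\exists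 y\,(x=Sy)$; (Q4) $x+0=x$; (Q5) $x+Sy=S(x+y)$; (Q6) $x\cdot0=0$; (Q7) $x\cdot Sy=x\cdot y+x$; (Q8) $x\leqslant y\leftrightarrow\exists r\,(r+x=y)$; (E1) $\exp(0)=S(0)$; (E2) $\exp(S(x))=\exp(x)+\exp(x)$; and the induction scheme $\big(\varphi(0,\bar y)\wedge\forall x(\varphi(x,\bar y)\to\varphi(S(x),\bar y))\big)\to\forall x\,\varphi(x,\bar y)$ for every quantifier-free formula $\varphi$ of this language. -}

module Defs where

open import Level using (0ℓ)
open import Data.Nat using (ℕ; suc)
open import Data.Fin using (Fin)
open import Data.Vec.Functional using (_∷_)
open import Data.Product using (Σ; ∃; _×_; _,_; proj₁; proj₂)
open import Data.Sum using (_⊎_; inj₁; inj₂)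
open import Data.Empty using (⊥; ⊥-elim)
open import Relation.Nullary using (¬_)
open import Relation.Binary using (Tri; tri<; tri≈; tri>)
open import Relation.Binary.Structures using (IsStrictTotalOrder)
open import Relation.Binary.PropositionalEquality
open import Algebra.Structures using (IsCommutativeRing)
open import Algebra.Bundles using (CommutativeRing)

record OrderedField : Set₁ where
  infixl 6 _+_
  infixl 7 _*_
  infix 4 _<_ _≤_
  field
    F       : Set
    _+_ _*_ : F → F → F
    -_      : F → F
    0# 1#   : F
    _<_     : F → F → Set
    isCommutativeRing : IsCommutativeRing _≡_ _+_ _*_ -_ 0# 1#
    0≢1     : ¬ (0# ≡ 1#)
    inverse : ∀ x → ¬ (x ≡ 0#) → ∃ λ y → x * y ≡ 1#
    isStrictTotalOrder : IsStrictTotalOrder _≡_ _<_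
    +-mono-< : ∀ x y z → x < y → x + z < y + z
    *-pos    : ∀ x y → 0# < x → 0# < y → 0# < x * y

  _≤_ : F → F → Set
  x ≤ y = (x < y) ⊎ (x ≡ y)

record ExpField : Set₁ where
  field
    orderedField : OrderedField
  open OrderedField orderedField public
  field
    exp      : F → F
    exp-pos  : ∀ x → 0# < exp x
    exp-hom  : ∀ x y → exp (x + y) ≡ exp x * exp y
    exp-mono : ∀ x y → x < y → exp x < exp y
    exp-surj : ∀ y → 0# < y → ∃ λ x → exp x ≡ y

data ORTerm (n : ℕ) : Set where
  var       : Fin n → ORTerm n
  zero' one' : ORTerm n
  _⊕_ _⊗_   : ORTerm n → ORTerm n → ORTerm n
  exp'      : ORTerm n → ORTerm n

module _ (R : ExpField) where
  open ExpField R

  evalOR : ∀ {n} → ORTerm n → (Fin n → F) → F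
  evalOR (var i)   ρ = ρ i
  evalOR zero'     ρ = 0#
  evalOR one'      ρ = 1#
  evalOR (t ⊕ s)   ρ = evalOR t ρ + evalOR s ρ
  evalOR (t ⊗ s)   ρ = evalOR t ρ * evalOR s ρ
  evalOR (exp' t)  ρ = exp (evalOR t ρ)

  MaxVal : Set
  MaxVal = ∀ (n : ℕ) (t : ORTerm (suc n)) (w : Fin n → F) (x y : F) → x < y →
    ∃ λ zmax → (x ≤ zmax × zmax ≤ y) ×
      (∀ z → x ≤ z → z ≤ y → evalOR t (z ∷ w) ≤ evalOR t (zmax ∷ w))

  record ExpIntegerPart (M : F → Set) : Set where
    field
      M-0 : M 0#
      M-1 : M 1#
      M-+ : ∀ x y → M x → M y → M (x + y)
      M-* : ∀ x y → M x → M y → M (x * y)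
      M-- : ∀ x → M x → M (- x)
      discrete : ∀ m → M m → 0# < m → 1# ≤ m
      integerPart : ∀ r → ∃ λ m → M m × m ≤ r × r < m + 1#
      M-exp : ∀ m → M m → 0# ≤ m → M (exp m) × 0# ≤ exp m

data ATerm (n : ℕ) : Set where
  var  : Fin n → ATerm n
  𝟘    : ATerm n
  𝑆    : ATerm n → ATerm n
  _⊕_ _⊗_ : ATerm n → ATerm n → ATerm n
  exp' : ATerm n → ATerm n

data QF (n : ℕ) : Set where
  _≐_ _≼_ : ATerm n → ATerm n → QF n
  ¬'_     : QF n → QF n
  _∧'_ _∨'_ _⇒'_ : QF n → QF n → QF n

record AStructure : Set₁ where
  field
    A     : Set
    _≈_   : A → A → Set
    zero  : A
    S     : A → A
    _+_ _*_ : A → A → A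
    _≤_   : A → A → Set
    exp   : A → A

module _ (𝔄 : AStructure) where
  open AStructure 𝔄

  evalA : ∀ {n} → ATerm n → (Fin n → A) → A
  evalA (var i)  ρ = ρ i
  evalA 𝟘        ρ = zero
  evalA (𝑆 t)    ρ = S (evalA t ρ)
  evalA (t ⊕ s)  ρ = evalA t ρ + evalA s ρ
  evalA (t ⊗ s)  ρ = evalA t ρ * evalA s ρ
  evalA (exp' t) ρ = exp (evalA t ρ)

  Sat : ∀ {n} → QF n → (Fin n → A) → Set
  Sat (t ≐ s)  ρ = evalA t ρ ≈ evalA s ρ
  Sat (t ≼ s)  ρ = evalA t ρ ≤ evalA s ρ
  Sat (¬' φ)   ρ = ¬ Sat φ ρ
  Sat (φ ∧' ψ) ρ = Sat φ ρ × Sat ψ ρ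
  Sat (φ ∨' ψ) ρ = Sat φ ρ ⊎ Sat ψ ρ
  Sat (φ ⇒' ψ) ρ = Sat φ ρ → Sat ψ ρ

  record ModelOfIOpenExp : Set where
    field
      Q1 : ∀ x → ¬ (S x ≈ zero)
      Q2 : ∀ x y → S x ≈ S y → x ≈ y
      Q3 : ∀ x → ¬ (x ≈ zero) → ∃ λ y → x ≈ S y
      Q4 : ∀ x → (x + zero) ≈ x
      Q5 : ∀ x y → (x + S y) ≈ S (x + y)
      Q6 : ∀ x → (x * zero) ≈ zero
      Q7 : ∀ x y → (x * S y) ≈ ((x * y) + x)
      Q8 : ∀ x y → (x ≤ y → ∃ λ r → (r + x) ≈ y) × ((∃ λ r → (r + x) ≈ y) → x ≤ y)
      E1 : exp zero ≈ S zero
      E2 : ∀ x → exp (S x) ≈ (exp x + exp x)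
      IOpen : ∀ (n : ℕ) (φ : QF (suc n)) (ys : Fin n → A) →
        Sat φ (zero ∷ ys) → (∀ x → Sat φ (x ∷ ys) → Sat φ (S x ∷ ys)) →
        ∀ x → Sat φ (x ∷ ys)

module OFFacts (K : OrderedField) where
  open OrderedField K
  module STO = IsStrictTotalOrder isStrictTotalOrder
  CR : CommutativeRing 0ℓ 0ℓ
  CR = record { isCommutativeRing = isCommutativeRing }
  open CommutativeRing CR using (ring; +-identityˡ; +-identityʳ; +-comm; -‿inverseʳ; zeroʳ)
  open import Algebra.Properties.Ring ring using (-1*x≈-x; -‿involutive)

  0<1 : 0# < 1#
  0<1 with STO.compare 0# 1#
  ... | tri< a _ _ = a
  ... | tri≈ _ b _ = ⊥-elim (0≢1 b)
  ... | tri> _ _ c = ⊥-elim (STO.irrefl refl (STO.trans c 0<1'))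
    where
    0<-1 : 0# < - 1#
    0<-1 = subst₂ _<_ (-‿inverseʳ 1#) (+-identityˡ (- 1#)) (+-mono-< 1# 0# (- 1#) c)
    0<1' : 0# < 1#
    0<1' = subst (0# <_) (trans (-1*x≈-x (- 1#)) (-‿involutive 1#)) (*-pos _ _ 0<-1 0<-1)

  ≤-+ : ∀ x y → 0# ≤ x → 0# ≤ y → 0# ≤ x + y
  ≤-+ x y (inj₂ refl) (inj₂ refl) = inj₂ (sym (+-identityˡ 0#))
  ≤-+ x y (inj₂ refl) (inj₁ p) = inj₁ (subst (0# <_) (sym (+-identityˡ y)) p)
  ≤-+ x y (inj₁ p) (inj₂ refl) = inj₁ (subst (0# <_) (sym (+-identityʳ x)) p)
  ≤-+ x y (inj₁ p) (inj₁ q) = inj₁ (STO.trans q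
    (subst (_< x + y) (+-identityˡ y) (+-mono-< 0# x y p)))

  ≤-* : ∀ x y → 0# ≤ x → 0# ≤ y → 0# ≤ x * y
  ≤-* x y (inj₁ p) (inj₁ q) = inj₁ (*-pos x y p q)
  ≤-* x y _ (inj₂ refl) = inj₂ (sym (zeroʳ x))
  ≤-* x y (inj₂ refl) (inj₁ q) = inj₂ (sym (CommutativeRing.zeroˡ CR y))

module _ (R : ExpField) (M : ExpField.F R → Set) (IP : ExpIntegerPart R M) where
  open ExpField R
  open ExpIntegerPart IP
  open OFFacts orderedField

  M⁺ : Set
  M⁺ = Σ F λ r → M r × 0# ≤ r

  M⁺-structure : AStructure
  M⁺-structure = record
    { A    = M⁺
    ; _≈_  = λ a b → proj₁ a ≡ proj₁ b
    ; zero = 0# , M-0 , inj₂ refl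
    ; S    = λ a → (proj₁ a + 1#) , M-+ _ _ (proj₁ (proj₂ a)) M-1
                                  , ≤-+ _ _ (proj₂ (proj₂ a)) (inj₁ 0<1)
    ; _+_  = λ a b → (proj₁ a + proj₁ b) , M-+ _ _ (proj₁ (proj₂ a)) (proj₁ (proj₂ b))
                                          , ≤-+ _ _ (proj₂ (proj₂ a)) (proj₂ (proj₂ b))
    ; _*_  = λ a b → (proj₁ a * proj₁ b) , M-* _ _ (proj₁ (proj₂ a)) (proj₁ (proj₂ b))
                                          , ≤-* _ _ (proj₂ (proj₂ a)) (proj₂ (proj₂ b))
    ; _≤_  = λ a b → proj₁ a ≤ proj₁ b
    ; exp  = λ a → exp (proj₁ a) , M-exp _ (proj₁ (proj₂ a)) (proj₂ (proj₂ a))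
    }

{-# OPTIONS --safe #-}
module Submission where

-- Over R, a quantifier-free formula is a Boolean combination of sign conditions on
-- exponential polynomials in x, so it suffices that every such function changes sign finitely
-- often: then the formula has constant truth value between consecutive break points, and induction
-- crosses each break point p because ⌊p⌋ and ⌊p⌋ + 1 are related by the induction step.
--
-- MaxVal gives differentiability of exp (from an interior maximum of x - exp x on [0 , 1]), Rolle's
-- theorem, and zeros of strictly monotone terms; hence a term has finitely many sign changes if
-- its derivative has. Multiplying by exp h does not affect signs, so it is enough to reduce any
-- exponential polynomial to 0 by steps f ↦ exp (- h) · (exp h · f)′. For sums Σ aᵢ · exp gᵢ this is
-- an induction on the number of summands: a step with exponent h - g₁ acts on the coefficient a₁
-- as the step with exponent h, and otherwise only changes the aᵢ, so once a₁ has been reduced to 0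
-- (one exponential level lower) a summand disappears.

open import Defs
open import Data.Empty using (⊥; ⊥-elim)
open import Data.Fin using (Fin; zero; suc; _↑ˡ_; _↑ʳ_)
open import Data.Integer as ℤ using (ℤ; -[1+_]) renaming (+_ to pos)
import Data.Integer.Properties as ℤₚ
import Data.Maybe as Maybe
open import Data.Nat as ℕ using (ℕ; zero; suc)
import Data.Nat.Properties as ℕₚ
open import Data.Product using (∃; _×_; _,_; proj₁; proj₂)
open import Data.Sum using (_⊎_; inj₁; inj₂; [_,_]; [_,_]′)
open import Relation.Nullary using (¬_)
open import Relation.Nullary.Decidable using (dec⇒maybe)
open import Relation.Binary using (Tri; tri<; tri≈; tri>)
open import Relation.Binary.Structures using (IsStrictTotalOrder)
open import Relation.Binary.PropositionalEquality as ≡ using (_≡_)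
open import Algebra.Bundles using (CommutativeRing)
open import Algebra.Solver.Ring.AlmostCommutativeRing using (fromCommutativeRing; _-Raw-AlmostCommutative⟶_)

-- Ring solver with integer coefficients.

module IntegerCoefficientSolver {c ℓ} (R : CommutativeRing c ℓ) where
  open CommutativeRing R
  open import Algebra.Properties.Ring ring
  open import Algebra.Properties.AbelianGroup +-abelianGroup using (⁻¹-∙-comm)
  open import Algebra.Properties.Semiring.Mult.TCOptimised semiring using (×-homo-+; ×1-homo-*; 1+×) renaming (_×_ to _×ℕ_)
  open import Relation.Binary.Reasoning.Setoid setoid

  -- With this form of the multiple, `con (pos 0)`, `con (pos 1)` and `con (pos 2)` evaluate
  -- definitionally to `0#`, `1#` and `1# + 1#`, so solved equations match the goals as they stand.
  fromℤ : ℤ → Carrier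
  fromℤ (pos n)    = n ×ℕ 1#
  fromℤ -[1+ n ] = - (suc n ×ℕ 1#)

  fromℤ-neg : ∀ i → fromℤ (ℤ.- i) ≈ - fromℤ i
  fromℤ-neg (pos zero)  = sym -0#≈0#
  fromℤ-neg (pos (suc n)) = refl
  fromℤ-neg -[1+ n ]  = sym (-‿involutive _)

  fromℤ-⊖ : ∀ m n → fromℤ (m ℤ.⊖ n) ≈ m ×ℕ 1# - n ×ℕ 1#
  fromℤ-⊖ m zero = sym (trans (+-congˡ -0#≈0#) (+-identityʳ _))
  fromℤ-⊖ zero (suc n) = sym (+-identityˡ _)
  fromℤ-⊖ (suc m) (suc n) = begin
    fromℤ (suc m ℤ.⊖ suc n)           ≡⟨ ≡.cong fromℤ (ℤₚ.[1+m]⊖[1+n]≡m⊖n m n) ⟩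
    fromℤ (m ℤ.⊖ n)                   ≈⟨ fromℤ-⊖ m n ⟩
    x - y                             ≈⟨ +-congʳ (+-identityʳ x) ⟨
    (x + 0#) - y                      ≈⟨ +-congʳ (+-congˡ (-‿inverseʳ 1#)) ⟨
    (x + (1# - 1#)) - y               ≈⟨ +-congʳ (+-assoc _ _ _) ⟨
    ((x + 1#) - 1#) - y               ≈⟨ +-assoc _ _ _ ⟩
    (x + 1#) + (- 1# - y)             ≈⟨ +-cong (+-comm _ _) (⁻¹-∙-comm _ _) ⟩
    (1# + x) - (1# + y)               ≈⟨ +-cong (1+× m 1#) (-‿cong (1+× n 1#)) ⟨
    suc m ×ℕ 1# - suc n ×ℕ 1#           ∎
    where
    x y : Carrier
    x = m ×ℕ 1#
    y = n ×ℕ 1#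

  fromℤ-+ : ∀ i j → fromℤ (i ℤ.+ j) ≈ fromℤ i + fromℤ j
  fromℤ-+ (pos m)    (pos n)    = ×-homo-+ 1# m n
  fromℤ-+ (pos m)    -[1+ n ] = fromℤ-⊖ m (suc n)
  fromℤ-+ -[1+ m ] (pos n)    = trans (fromℤ-⊖ n (suc m)) (+-comm _ _)
  fromℤ-+ -[1+ m ] -[1+ n ] = begin
    - (suc (suc (m ℕ.+ n)) ×ℕ 1#)        ≡⟨ ≡.cong (λ k → - (suc k ×ℕ 1#)) (ℕₚ.+-suc m n) ⟨
    - ((suc m ℕ.+ suc n) ×ℕ 1#)          ≈⟨ -‿cong (×-homo-+ 1# (suc m) (suc n)) ⟩
    - (suc m ×ℕ 1# + suc n ×ℕ 1#)         ≈⟨ ⁻¹-∙-comm _ _ ⟨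
    - (suc m ×ℕ 1#) + - (suc n ×ℕ 1#)     ∎

  fromℤ-pos* : ∀ m j → fromℤ (pos m ℤ.* j) ≈ m ×ℕ 1# * fromℤ j
  fromℤ-pos* m (pos n)    = trans (reflexive (≡.cong fromℤ (≡.sym (ℤₚ.pos-* m n)))) (×1-homo-* m n)
  fromℤ-pos* m -[1+ n ] = begin
    fromℤ (pos m ℤ.* -[1+ n ])            ≡⟨ ≡.cong fromℤ (ℤₚ.neg-distribʳ-* (pos m) (pos (suc n))) ⟨
    fromℤ (ℤ.- (pos m ℤ.* pos (suc n)))       ≈⟨ fromℤ-neg (pos m ℤ.* pos (suc n)) ⟩
    - fromℤ (pos m ℤ.* pos (suc n))           ≈⟨ -‿cong (fromℤ-pos* m (pos (suc n))) ⟩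
    - (m ×ℕ 1# * suc n ×ℕ 1#)             ≈⟨ -‿distribʳ-* _ _ ⟩
    m ×ℕ 1# * - (suc n ×ℕ 1#)             ∎

  fromℤ-* : ∀ i j → fromℤ (i ℤ.* j) ≈ fromℤ i * fromℤ j
  fromℤ-* (pos m)    j = fromℤ-pos* m j
  fromℤ-* -[1+ m ] j = begin
    fromℤ (-[1+ m ] ℤ.* j)              ≡⟨ ≡.cong fromℤ (ℤₚ.neg-distribˡ-* (pos (suc m)) j) ⟨
    fromℤ (ℤ.- (pos (suc m) ℤ.* j))         ≈⟨ fromℤ-neg (pos (suc m) ℤ.* j) ⟩
    - fromℤ (pos (suc m) ℤ.* j)             ≈⟨ -‿cong (fromℤ-pos* (suc m) j) ⟩
    - (suc m ×ℕ 1# * fromℤ j)            ≈⟨ -‿distribˡ-* _ _ ⟩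
    - (suc m ×ℕ 1#) * fromℤ j            ∎

  fromℤ-homomorphism : ℤ.+-*-rawRing -Raw-AlmostCommutative⟶ fromCommutativeRing R
  fromℤ-homomorphism = record
    { ⟦_⟧ = fromℤ ; +-homo = fromℤ-+ ; *-homo = fromℤ-* ; -‿homo = fromℤ-neg
    ; 0-homo = refl ; 1-homo = refl }

  open import Algebra.Solver.Ring ℤ.+-*-rawRing (fromCommutativeRing R) fromℤ-homomorphism
    (λ i j → Maybe.map (λ i≡j → reflexive (≡.cong fromℤ i≡j)) (dec⇒maybe (i ℤ.≟ j))) public

open ≡ using (refl; sym; trans; cong; cong₂; subst; subst₂)

-- Ordered fields: inequalities and two-sided bounds.

module OrderedFieldProperties (K : OrderedField) where
  open OrderedField K
  open OFFacts K public using (0<1; ≤-+; ≤-*; CR)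
  open CommutativeRing CR public using (_-_; +-identityˡ; +-identityʳ; +-assoc; +-comm; *-identityˡ; *-identityʳ; *-comm; zeroˡ; zeroʳ; -‿inverseʳ)
  open IsStrictTotalOrder isStrictTotalOrder public using (compare) renaming (trans to <-trans; irrefl to <-irrefl)
  open IntegerCoefficientSolver CR public using (solve; _:=_; _:+_; _:*_; _:-_; :-_; con)

  ≤-<-trans : ∀ {x y z} → x ≤ y → y < z → x < z
  ≤-<-trans (inj₁ p) q = <-trans p q
  ≤-<-trans (inj₂ refl) q = q

  <-≤-trans : ∀ {x y z} → x < y → y ≤ z → x < z
  <-≤-trans p (inj₁ q) = <-trans p q
  <-≤-trans p (inj₂ refl) = p

  ≤-trans : ∀ {x y z} → x ≤ y → y ≤ z → x ≤ z
  ≤-trans p (inj₁ q) = inj₁ (≤-<-trans p q)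
  ≤-trans p (inj₂ refl) = p

  ≤-refl : ∀ {x} → x ≤ x
  ≤-refl = inj₂ refl

  <⇒≱ : ∀ {x y} → x < y → ¬ y ≤ x
  <⇒≱ p q = <-irrefl refl (<-≤-trans p q)

  <-≤-connex : ∀ x y → x < y ⊎ y ≤ x
  <-≤-connex x y with compare x y
  ... | tri< p _ _ = inj₁ p
  ... | tri≈ _ p _ = inj₂ (inj₂ (sym p))
  ... | tri> _ _ p = inj₂ (inj₁ p)

  ≤-antisym : ∀ {x y} → x ≤ y → y ≤ x → x ≡ y
  ≤-antisym (inj₂ p) _ = p
  ≤-antisym (inj₁ p) q = ⊥-elim (<⇒≱ p q)

  <-from-difference : ∀ {x y} d → 0# < d → x + d ≡ y → x < y
  <-from-difference {x} d p refl = subst₂ _<_ (+-identityˡ x) (+-comm d x) (+-mono-< 0# d x p)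

  ≤-from-difference : ∀ {x y} d → 0# ≤ d → x + d ≡ y → x ≤ y
  ≤-from-difference d (inj₁ p) e = inj₁ (<-from-difference d p e)
  ≤-from-difference {x} d (inj₂ refl) e = inj₂ (trans (sym (+-identityʳ x)) e)

  x<y⇒0<y-x : ∀ {x y} → x < y → 0# < y - x
  x<y⇒0<y-x {x} {y} p = subst (_< y - x) (-‿inverseʳ x) (+-mono-< x y (- x) p)

  x≤y⇒0≤y-x : ∀ {x y} → x ≤ y → 0# ≤ y - x
  x≤y⇒0≤y-x (inj₁ p) = inj₁ (x<y⇒0<y-x p)
  x≤y⇒0≤y-x {x} (inj₂ refl) = inj₂ (sym (-‿inverseʳ x))

  0<y-x⇒x<y : ∀ {x y} → 0# < y - x → x < y
  0<y-x⇒x<y {x} {y} p = <-from-difference _ p (solve 2 (λ x y → x :+ (y :- x) := y) refl x y)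

  0≤y-x⇒x≤y : ∀ {x y} → 0# ≤ y - x → x ≤ y
  0≤y-x⇒x≤y {x} {y} p = ≤-from-difference _ p (solve 2 (λ x y → x :+ (y :- x) := y) refl x y)

  x-y≡0⇒x≡y : ∀ {x y} → x - y ≡ 0# → x ≡ y
  x-y≡0⇒x≡y {x} {y} p = trans (solve 2 (λ x y → x := x :- y :+ y) refl x y) (trans (cong (_+ y) p) (+-identityˡ y))

  x<0⇒0<-x : ∀ {x} → x < 0# → 0# < - x
  x<0⇒0<-x {x} p = subst (0# <_) (+-identityˡ (- x)) (x<y⇒0<y-x p)

  0<-x⇒x<0 : ∀ {x} → 0# < - x → x < 0#
  0<-x⇒x<0 {x} p = 0<y-x⇒x<y (subst (0# <_) (sym (+-identityˡ (- x))) p)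

  +-pos-≤ : ∀ {x y} → 0# < x → 0# ≤ y → 0# < x + y
  +-pos-≤ {x} {y} p q = <-≤-trans p (≤-from-difference y q refl)

  pos⇒x<x+y : ∀ {x y} → 0# < y → x < x + y
  pos⇒x<x+y p = <-from-difference _ p refl

  opaque
    inverse-pos : ∀ {x} → 0# < x → ∃ λ y → 0# < y × x * y ≡ 1#
    inverse-pos {x} p with inverse x (λ e → <-irrefl (sym e) p)
    ... | y , xy≡1 with compare 0# y
    ... | tri< q _ _ = y , q , xy≡1
    ... | tri≈ _ refl _ = ⊥-elim (0≢1 (trans (sym (zeroʳ x)) xy≡1))
    ... | tri> _ _ q = ⊥-elim (<⇒≱ (*-pos _ _ p (x<0⇒0<-x q)) (inj₁ (0<-x⇒x<0 (subst (0# <_) 1≡ 0<1))))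
      where
      1≡ : 1# ≡ - (x * - y)
      1≡ = trans (sym xy≡1) (solve 2 (λ x y → x :* y := :- (x :* :- y)) refl x y)

  *-cancelˡ-nonneg : ∀ {x y} → 0# < x → 0# ≤ x * y → 0# ≤ y
  *-cancelˡ-nonneg {x} {y} p q with <-≤-connex y 0#
  ... | inj₂ r = r
  ... | inj₁ r = ⊥-elim (<⇒≱ (0<-x⇒x<0 (subst (0# <_) e (*-pos _ _ p (x<0⇒0<-x r)))) q)
    where
    e : x * - y ≡ - (x * y)
    e = solve 2 (λ x y → x :* :- y := :- (x :* y)) refl x y

  *-cancelˡ-zero : ∀ {x y} → 0# < x → x * y ≡ 0# → y ≡ 0#
  *-cancelˡ-zero {x} {y} p q = ≤-antisym
    (0≤y-x⇒x≤y (*-cancelˡ-nonneg p (inj₂ (sym (trans (solve 2 (λ x y → x :* (con (pos 0) :- y) := :- (x :* y)) refl x y) (trans (cong -_ q) -0≡0))))))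
    (*-cancelˡ-nonneg p (inj₂ (sym q)))
    where
    -0≡0 : - 0# ≡ 0#
    -0≡0 = solve 0 (:- con (pos 0) := con (pos 0)) refl

  opaque
    0<2 : 0# < 1# + 1#
    0<2 = +-pos-≤ 0<1 (inj₁ 0<1)

  ½ : F
  ½ = proj₁ (inverse-pos 0<2)

  0<½ : 0# < ½
  0<½ = proj₁ (proj₂ (inverse-pos 0<2))

  opaque
    ½+½≡1 : ½ + ½ ≡ 1#
    ½+½≡1 = trans (solve 1 (λ h → h :+ h := con (pos 2) :* h) refl ½) (proj₂ (proj₂ (inverse-pos 0<2)))

  half-sum : ∀ x → ½ * x + ½ * x ≡ x
  half-sum x = trans (solve 2 (λ h x → h :* x :+ h :* x := (h :+ h) :* x) refl ½ x) (trans (cong (_* x) ½+½≡1) (*-identityˡ x))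

  0<½* : ∀ {x} → 0# < x → 0# < ½ * x
  0<½* = *-pos _ _ 0<½

  halve-nonneg : ∀ {x} → 0# ≤ x + x → 0# ≤ x
  halve-nonneg {x} p = *-cancelˡ-nonneg 0<2 (subst (0# ≤_) (solve 1 (λ x → x :+ x := con (pos 2) :* x) refl x) p)

  midpoint : F → F → F
  midpoint u v = u + ½ * (v - u)

  u<midpoint : ∀ {u v} → u < v → u < midpoint u v
  u<midpoint p = pos⇒x<x+y (0<½* (x<y⇒0<y-x p))

  midpoint<v : ∀ {u v} → u < v → midpoint u v < v
  midpoint<v {u} {v} p = <-from-difference _ (0<½* (x<y⇒0<y-x p))
    (trans (solve 2 (λ u a → u :+ a :+ a := u :+ (a :+ a)) refl u (½ * (v - u)))
      (trans (cong (u +_) (half-sum _)) (solve 2 (λ u v → u :+ (v :- u) := v) refl u v)))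

  opaque
    lower-bound : ∀ {x y} → 0# < x → 0# < y → ∃ λ z → 0# < z × z ≤ x × z ≤ y
    lower-bound {x} {y} p q with <-≤-connex x y
    ... | inj₁ r = x , p , ≤-refl , inj₁ r
    ... | inj₂ r = y , q , r , ≤-refl

  -- A two-sided bound ∣ x ∣ ≤ B, in a form that only needs nonnegativity.
  Bounded : F → F → Set
  Bounded x B = 0# ≤ B + x × 0# ≤ B - x

  opaque
    bounded-exists : ∀ x → ∃ λ B → 0# < B × Bounded x B
    bounded-exists x with compare 0# x
    ... | tri< p _ _ = x + 1# , +-pos-≤ p (inj₁ 0<1) , ≤-+ _ _ (inj₁ (+-pos-≤ p (inj₁ 0<1))) (inj₁ p)
                     , subst (0# ≤_) (solve 1 (λ x → con (pos 1) := x :+ con (pos 1) :- x) refl x) (inj₁ 0<1)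
    ... | tri≈ _ refl _ = 1# , 0<1 , subst (0# ≤_) (sym (+-identityʳ 1#)) (inj₁ 0<1)
                     , subst (0# ≤_) (solve 0 (con (pos 1) := con (pos 1) :- con (pos 0)) refl) (inj₁ 0<1)
    ... | tri> _ _ p = - x + 1# , +-pos-≤ (x<0⇒0<-x p) (inj₁ 0<1)
                     , subst (0# ≤_) (solve 1 (λ x → con (pos 1) := :- x :+ con (pos 1) :+ x) refl x) (inj₁ 0<1)
                     , ≤-+ _ _ (inj₁ (+-pos-≤ (x<0⇒0<-x p) (inj₁ 0<1))) (inj₁ (x<0⇒0<-x p))

  bounded-self : ∀ {x} → 0# ≤ x → Bounded x x
  bounded-self {x} p = ≤-+ _ _ p p , inj₂ (sym (-‿inverseʳ x))

  bounded-mono : ∀ {x A B} → A ≤ B → Bounded x A → Bounded x B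
  bounded-mono {x} {A} {B} p (l , u) =
    subst (0# ≤_) (solve 3 (λ x A B → B :- A :+ (A :+ x) := B :+ x) refl x A B) (≤-+ _ _ (x≤y⇒0≤y-x p) l) ,
    subst (0# ≤_) (solve 3 (λ x A B → B :- A :+ (A :- x) := B :- x) refl x A B) (≤-+ _ _ (x≤y⇒0≤y-x p) u)

  bounded-+ : ∀ {x y A B} → Bounded x A → Bounded y B → Bounded (x + y) (A + B)
  bounded-+ {x} {y} {A} {B} (l , u) (l′ , u′) =
    subst (0# ≤_) (solve 4 (λ x y A B → (A :+ x) :+ (B :+ y) := A :+ B :+ (x :+ y)) refl x y A B) (≤-+ _ _ l l′) ,
    subst (0# ≤_) (solve 4 (λ x y A B → (A :- x) :+ (B :- y) := A :+ B :- (x :+ y)) refl x y A B) (≤-+ _ _ u u′)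

  -- No case distinction on signs: (A + x)(B + y) + (A - x)(B - y) = 2(AB + xy) is a sum of products
  -- of nonnegative factors, and AB - xy arises in the same way.
  bounded-* : ∀ {x y A B} → Bounded x A → Bounded y B → Bounded (x * y) (A * B)
  bounded-* {x} {y} {A} {B} (l , u) (l′ , u′) =
    halve-nonneg (subst (0# ≤_)
      (solve 4 (λ x y A B → (A :+ x) :* (B :+ y) :+ (A :- x) :* (B :- y) := A :* B :+ x :* y :+ (A :* B :+ x :* y)) refl x y A B)
      (≤-+ _ _ (≤-* _ _ l l′) (≤-* _ _ u u′))) ,
    halve-nonneg (subst (0# ≤_)
      (solve 4 (λ x y A B → (A :- x) :* (B :+ y) :+ (A :+ x) :* (B :- y) := A :* B :- x :* y :+ (A :* B :- x :* y)) refl x y A B)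
      (≤-+ _ _ (≤-* _ _ u l′) (≤-* _ _ l u′)))

  *-monoˡ-≤ : ∀ {x y z} → 0# ≤ x → y ≤ z → x * y ≤ x * z
  *-monoˡ-≤ {x} {y} {z} p q = ≤-from-difference _ (≤-* _ _ p (x≤y⇒0≤y-x q))
    (solve 3 (λ x y z → x :* y :+ x :* (z :- y) := x :* z) refl x y z)

  *-monoʳ-≤ : ∀ {x y z} → 0# ≤ x → y ≤ z → y * x ≤ z * x
  *-monoʳ-≤ {x} {y} {z} p q = subst₂ _≤_ (*-comm x y) (*-comm x z) (*-monoˡ-≤ p q)

  -- Landau symbols at 0 for germs of functions; ρ plays the role of ∣ h ∣.
  BigO : (F → F) → Set
  BigO u = ∃ λ C → 0# < C × ∃ λ δ → 0# < δ × (∀ ρ h → 0# ≤ ρ → ρ ≤ δ → Bounded h ρ → Bounded (u h) (C * ρ))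

  LittleO : (F → F) → Set
  LittleO r = ∀ η → 0# < η → ∃ λ δ → 0# < δ × (∀ ρ h → 0# ≤ ρ → ρ ≤ δ → Bounded h ρ → Bounded (r h) (η * ρ))

  opaque
    littleO-zero : LittleO (λ _ → 0#)
    littleO-zero η 0<η = 1# , 0<1 , λ ρ h 0≤ρ _ _ →
      bounded-mono (≤-* _ _ (inj₁ 0<η) 0≤ρ) (bounded-self ≤-refl)

  opaque
    littleO-+ : ∀ {r s} → LittleO r → LittleO s → LittleO (λ h → r h + s h)
    littleO-+ or os η 0<η with or (½ * η) (0<½* 0<η) | os (½ * η) (0<½* 0<η)
    ... | δ₁ , p₁ , b₁ | δ₂ , p₂ , b₂ with lower-bound p₁ p₂
    ... | δ , p , δ≤δ₁ , δ≤δ₂ = δ , p , λ ρ h 0≤ρ ρ≤δ bh →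
      subst (Bounded _) (trans (solve 2 (λ x y → x :* y :+ x :* y := (x :+ x) :* y) refl (½ * η) ρ) (cong (_* ρ) (half-sum η)))
        (bounded-+ (b₁ ρ h 0≤ρ (≤-trans ρ≤δ δ≤δ₁) bh) (b₂ ρ h 0≤ρ (≤-trans ρ≤δ δ≤δ₂) bh))

  opaque
    littleO-scale : ∀ {r} k → LittleO r → LittleO (λ h → k * r h)
    littleO-scale k or η 0<η with bounded-exists k
    ... | B , 0<B , bk with inverse-pos 0<B
    ... | B⁻¹ , 0<B⁻¹ , BB⁻¹≡1 with or (η * B⁻¹) (*-pos _ _ 0<η 0<B⁻¹)
    ... | δ , p , b = δ , p , λ ρ h 0≤ρ ρ≤δ bh →
      subst (Bounded _)
        (trans (solve 4 (λ B C η ρ → B :* (η :* C :* ρ) := B :* C :* (η :* ρ)) refl B B⁻¹ η ρ)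
          (trans (cong (_* (η * ρ)) BB⁻¹≡1) (*-identityˡ _)))
        (bounded-* bk (b ρ h 0≤ρ ρ≤δ bh))

  opaque
    bigO-+-littleO : ∀ {r} d → LittleO r → BigO (λ h → d * h + r h)
    bigO-+-littleO d or with bounded-exists d | or 1# 0<1
    ... | B , 0<B , bd | δ , p , b = B + 1# , +-pos-≤ 0<B (inj₁ 0<1) , δ , p , λ ρ h 0≤ρ ρ≤δ bh →
      subst (Bounded _) (solve 2 (λ B ρ → B :* ρ :+ con (pos 1) :* ρ := (B :+ con (pos 1)) :* ρ) refl B ρ)
        (bounded-+ (bounded-* bd bh) (b ρ h 0≤ρ ρ≤δ bh))

  opaque
    -- The product is bounded by A · B · ρ², and this is at most η · ρ once ρ ≤ η / (A · B); `C` is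
    -- the inverse of A · B.
    bigO-*-bigO : ∀ {u v} → BigO u → BigO v → LittleO (λ h → u h * v h)
    bigO-*-bigO (A , 0<A , δ₁ , p₁ , b₁) (B , 0<B , δ₂ , p₂ , b₂) η 0<η
      with inverse-pos (*-pos _ _ 0<A 0<B)
    ... | C , 0<C , ABC≡1 with lower-bound p₁ p₂
    ... | δ₃ , p₃ , δ₃≤δ₁ , δ₃≤δ₂ with lower-bound p₃ (*-pos _ _ 0<C 0<η)
    ... | δ , p , δ≤δ₃ , δ≤Cη = δ , p , λ ρ h 0≤ρ ρ≤δ bh →
      bounded-mono
        (subst₂ _≤_ (solve 3 (λ A B ρ → A :* B :* ρ :* ρ := A :* ρ :* (B :* ρ)) refl A B ρ)
          (trans (solve 5 (λ A B C η ρ → A :* B :* (C :* η) :* ρ := A :* B :* C :* (η :* ρ)) refl A B C η ρ)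
            (trans (cong (_* (η * ρ)) ABC≡1) (*-identityˡ _)))
          (*-monoʳ-≤ 0≤ρ (*-monoˡ-≤ (inj₁ (*-pos _ _ 0<A 0<B)) (≤-trans ρ≤δ δ≤Cη))))
        (bounded-* (b₁ ρ h 0≤ρ (≤-trans ρ≤δ (≤-trans δ≤δ₃ δ₃≤δ₁)) bh) (b₂ ρ h 0≤ρ (≤-trans ρ≤δ (≤-trans δ≤δ₃ δ₃≤δ₂)) bh))

  opaque
    -- The estimate for `r` is used at radius A · ρ with precision η / A, which requires ρ ≤ δ₂ / A.
    littleO-∘-bigO : ∀ {r u} → LittleO r → BigO u → LittleO (λ h → r (u h))
    littleO-∘-bigO or (A , 0<A , δ₁ , p₁ , b₁) η 0<η with inverse-pos 0<A
    ... | C , 0<C , AC≡1 with or (η * C) (*-pos _ _ 0<η 0<C)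
    ... | δ₂ , p₂ , b₂ with lower-bound p₁ (*-pos _ _ 0<C p₂)
    ... | δ , p , δ≤δ₁ , δ≤Cδ₂ = δ , p , λ ρ h 0≤ρ ρ≤δ bh →
      subst (Bounded _) (cancel₂ ρ)
        (b₂ (A * ρ) _ (≤-* _ _ (inj₁ 0<A) 0≤ρ)
          (subst (A * ρ ≤_) cancel₁ (*-monoˡ-≤ (inj₁ 0<A) (≤-trans ρ≤δ δ≤Cδ₂)))
          (b₁ ρ h 0≤ρ (≤-trans ρ≤δ δ≤δ₁) bh))
      where
      cancel₁ : A * (C * δ₂) ≡ δ₂
      cancel₁ = trans (solve 3 (λ A C d → A :* (C :* d) := A :* C :* d) refl A C δ₂) (trans (cong (_* δ₂) AC≡1) (*-identityˡ _))
      cancel₂ : ∀ ρ → η * C * (A * ρ) ≡ η * ρ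
      cancel₂ ρ = trans (solve 4 (λ A C η ρ → η :* C :* (A :* ρ) := A :* C :* (η :* ρ)) refl A C η ρ) (trans (cong (_* (η * ρ)) AC≡1) (*-identityˡ _))

  -- A first-order expansion instead of a limit of quotients: each differentiation rule becomes a
  -- ring identity together with a Landau estimate for the remainder.
  record HasDerivative (f : F → F) (z d : F) : Set where
    constructor has-derivative
    field
      remainder : F → F
      expansion : ∀ h → f (z + h) ≡ f z + (d * h + remainder h)
      littleO   : LittleO remainder

  -- Rules of differentiation.

  opaque
    derivative-const : ∀ k z → HasDerivative (λ _ → k) z 0#
    derivative-const k z = has-derivative (λ _ → 0#) (λ h → solve 2 (λ k h → k := k :+ (con (pos 0) :* h :+ con (pos 0))) refl k h) littleO-zero

  opaque
    derivative-id : ∀ z → HasDerivative (λ x → x) z 1#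
    derivative-id z = has-derivative (λ _ → 0#) (λ h → solve 2 (λ z h → z :+ h := z :+ (con (pos 1) :* h :+ con (pos 0))) refl z h) littleO-zero

  opaque
    derivative-+ : ∀ {f g z d e} → HasDerivative f z d → HasDerivative g z e → HasDerivative (λ x → f x + g x) z (d + e)
    derivative-+ {f} {g} {z} {d} {e} (has-derivative r p or) (has-derivative s q os) = has-derivative
      (λ h → r h + s h)
      (λ h → trans (cong₂ _+_ (p h) (q h))
        (solve 7 (λ f g d e h r s → f :+ (d :* h :+ r) :+ (g :+ (e :* h :+ s)) := f :+ g :+ ((d :+ e) :* h :+ (r :+ s))) refl
          (f z) (g z) d e h (r h) (s h)))
      (littleO-+ or os)

  opaque
    derivative-* : ∀ {f g z d e} → HasDerivative f z d → HasDerivative g z e →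
      HasDerivative (λ x → f x * g x) z (d * g z + f z * e)
    derivative-* {f} {g} {z} {d} {e} (has-derivative r p or) (has-derivative s q os) = has-derivative
      (λ h → g z * r h + f z * s h + (d * h + r h) * (e * h + s h))
      (λ h → trans (cong₂ _*_ (p h) (q h))
        (solve 7 (λ f g d e h r s → (f :+ (d :* h :+ r)) :* (g :+ (e :* h :+ s)) :=
            f :* g :+ ((d :* g :+ f :* e) :* h :+ (g :* r :+ f :* s :+ (d :* h :+ r) :* (e :* h :+ s)))) refl
          (f z) (g z) d e h (r h) (s h)))
      (littleO-+ (littleO-+ (littleO-scale (g z) or) (littleO-scale (f z) os)) (bigO-*-bigO (bigO-+-littleO d or) (bigO-+-littleO e os)))

  opaque
    derivative-scale : ∀ {f z d} k → HasDerivative f z d → HasDerivative (λ x → k * f x) z (k * d)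
    derivative-scale {f} {z} {d} k p = subst (HasDerivative _ z)
      (solve 3 (λ k f d → con (pos 0) :* f :+ k :* d := k :* d) refl k (f z) d)
      (derivative-* (derivative-const k z) p)

  -- Local consequences of the first-order expansion.

  opaque
    -- For small ρ the remainder is at most half of the linear term d · σ · ρ, so the other half is
    -- a genuine gain. The direction σ will be 1 or -1.
    increases-along : ∀ {f z d} σ → Bounded σ 1# → HasDerivative f z d → 0# < d * σ →
      ∃ λ δ → 0# < δ × (∀ ρ → 0# < ρ → ρ ≤ δ → f z < f (z + σ * ρ))
    increases-along {f} {z} {d} σ bσ (has-derivative r p or) 0<dσ with or (½ * (d * σ)) (0<½* 0<dσ)
    ... | δ , 0<δ , b = δ , 0<δ , λ ρ 0<ρ ρ≤δ →
      <-from-difference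
        (½ * (d * σ) * ρ + (½ * (d * σ) * ρ + r (σ * ρ)))
        (+-pos-≤ (*-pos _ _ (0<½* 0<dσ) 0<ρ)
          (proj₁ (b ρ (σ * ρ) (inj₁ 0<ρ) ρ≤δ (subst (Bounded _) (*-identityˡ ρ) (bounded-* bσ (bounded-self (inj₁ 0<ρ)))))))
        (trans
          (cong (f z +_) (trans
            (solve 3 (λ a ρ r → a :* ρ :+ (a :* ρ :+ r) := (a :+ a) :* ρ :+ r) refl (½ * (d * σ)) ρ (r (σ * ρ)))
            (trans (cong (λ a → a * ρ + r (σ * ρ)) (half-sum (d * σ)))
              (solve 4 (λ d σ ρ r → d :* σ :* ρ :+ r := d :* (σ :* ρ) :+ r) refl d σ ρ (r (σ * ρ))))))
          (sym (p (σ * ρ))))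

  opaque
    -- If `d` were nonzero, moving from `z` in the direction of the sign of `d` would stay inside
    -- [u , v] and exceed the maximum.
    interior-maximum : ∀ {f z d u v} → HasDerivative f z d → u < z → z < v →
      (∀ x → u ≤ x → x ≤ v → f x ≤ f z) → d ≡ 0#
    interior-maximum {f} {z} {d} {u} {v} fz u<z z<v max = conclude (compare d 0#)
      where
      no-increase : ∀ σ → Bounded σ 1# → 0# < d * σ →
        (∀ ρ → 0# < ρ → ρ ≤ v - z → ρ ≤ z - u → u ≤ z + σ * ρ × z + σ * ρ ≤ v) → ⊥
      no-increase σ bσ 0<dσ inside with increases-along σ bσ fz 0<dσ
      ... | δ , 0<δ , inc with lower-bound (x<y⇒0<y-x z<v) (x<y⇒0<y-x u<z)
      ... | ρ₁ , 0<ρ₁ , ρ₁≤v-z , ρ₁≤z-u with lower-bound 0<δ 0<ρ₁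
      ... | ρ , 0<ρ , ρ≤δ , ρ≤ρ₁ with inside ρ 0<ρ (≤-trans ρ≤ρ₁ ρ₁≤v-z) (≤-trans ρ≤ρ₁ ρ₁≤z-u)
      ... | u≤x , x≤v = <⇒≱ (inc ρ 0<ρ ρ≤δ) (max _ u≤x x≤v)

      bounded-neg-one : Bounded (- 1#) 1#
      bounded-neg-one = inj₂ (sym (-‿inverseʳ 1#)) , subst (0# ≤_) (solve 0 (con (pos 2) := con (pos 1) :- (:- con (pos 1))) refl) (inj₁ 0<2)

      conclude : Tri (d < 0#) (d ≡ 0#) (0# < d) → d ≡ 0#
      conclude (tri≈ _ d≡0 _) = d≡0
      conclude (tri> _ _ 0<d) = ⊥-elim (no-increase 1# (bounded-self (inj₁ 0<1)) (subst (0# <_) (sym (*-identityʳ d)) 0<d)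
        λ ρ 0<ρ ρ≤v-z _ →
          inj₁ (<-trans u<z (<-from-difference ρ 0<ρ (cong (z +_) (sym (*-identityˡ ρ))))) ,
          ≤-from-difference _ (x≤y⇒0≤y-x ρ≤v-z) (solve 3 (λ z v ρ → z :+ con (pos 1) :* ρ :+ (v :- z :- ρ) := v) refl z v ρ))
      conclude (tri< d<0 _ _) = ⊥-elim (no-increase (- 1#) bounded-neg-one
        (subst (0# <_) (solve 1 (λ d → :- d := d :* :- con (pos 1)) refl d) (x<0⇒0<-x d<0))
        λ ρ 0<ρ _ ρ≤z-u →
          ≤-from-difference _ (x≤y⇒0≤y-x ρ≤z-u) (solve 3 (λ z u ρ → u :+ (z :- u :- ρ) := z :+ :- con (pos 1) :* ρ) refl z u ρ) ,
          inj₁ (<-trans (<-from-difference ρ 0<ρ (solve 2 (λ z ρ → z :+ :- con (pos 1) :* ρ :+ ρ := z) refl z ρ)) z<v))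

  opaque
    -- The increment of `f` is at most C · δ, and `δ` is chosen to make this at most half of `f z`.
    positive-nearby : ∀ {f z d} → HasDerivative f z d → 0# < f z →
      ∃ λ δ → 0# < δ × (∀ h → Bounded h δ → 0# < f (z + h))
    positive-nearby {f} {z} {d} (has-derivative r p or) 0<fz with bigO-+-littleO d or
    ... | C , 0<C , δ₁ , 0<δ₁ , b with inverse-pos 0<C
    ... | C⁻¹ , 0<C⁻¹ , CC⁻¹≡1 with lower-bound 0<δ₁ (*-pos _ _ 0<C⁻¹ (0<½* 0<fz))
    ... | δ , 0<δ , δ≤δ₁ , δ≤ = δ , 0<δ , λ h bh →
      subst (0# <_)
        (trans (solve 2 (λ a u → a :+ (a :+ u) := a :+ a :+ u) refl (½ * f z) (d * h + r h))
          (trans (cong (_+ (d * h + r h)) (half-sum (f z))) (sym (p h))))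
        (+-pos-≤ (0<½* 0<fz) (proj₁ (bounded-mono Cδ≤ (b δ h (inj₁ 0<δ) δ≤δ₁ bh))))
      where
      Cδ≤ : C * δ ≤ ½ * f z
      Cδ≤ = subst (C * δ ≤_)
        (trans (solve 3 (λ A C d → A :* (C :* d) := A :* C :* d) refl C C⁻¹ (½ * f z)) (trans (cong (_* (½ * f z)) CC⁻¹≡1) (*-identityˡ _)))
        (*-monoˡ-≤ (inj₁ 0<C) δ≤)

-- Functions defined by terms with parameters, their maxima, and the exponential.

renameOR : ∀ {m n} → (Fin m → Fin n) → ORTerm m → ORTerm n
renameOR σ (var i)  = var (σ i)
renameOR σ zero'    = zero'
renameOR σ one'     = one'
renameOR σ (t ⊕ s)  = renameOR σ t ⊕ renameOR σ s
renameOR σ (t ⊗ s)  = renameOR σ t ⊗ renameOR σ s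
renameOR σ (exp' t) = exp' (renameOR σ t)

module MaxValProperties (R : ExpField) (maxVal : MaxVal R)
  (exp1 : ExpField.exp R (ExpField.1# R) ≡ ExpField._+_ R (ExpField.1# R) (ExpField.1# R)) where
  open import Data.Vec.Functional using (_∷_; _++_)
  open import Data.Vec.Functional.Properties using (lookup-++ˡ; lookup-++ʳ)
  open ExpField R public
  open OrderedFieldProperties orderedField public

  evalOR-rename : ∀ {m n} (σ : Fin m → Fin n) (t : ORTerm m) {ρ : Fin m → F} {ρ′ : Fin n → F} →
    (∀ i → ρ′ (σ i) ≡ ρ i) → evalOR R (renameOR σ t) ρ′ ≡ evalOR R t ρ
  evalOR-rename σ (var i)  e = e i
  evalOR-rename σ zero'    e = refl
  evalOR-rename σ one'     e = refl
  evalOR-rename σ (t ⊕ s)  e = cong₂ _+_ (evalOR-rename σ t e) (evalOR-rename σ s e)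
  evalOR-rename σ (t ⊗ s)  e = cong₂ _*_ (evalOR-rename σ t e) (evalOR-rename σ s e)
  evalOR-rename σ (exp' t) e = cong exp (evalOR-rename σ t e)

  -- These are the functions to which `MaxVal` applies. Working with functions and keeping the term
  -- as a witness allows them to be combined up to pointwise equality.
  record IsTerm (f : F → F) : Set where
    field
      {arity} : ℕ
      term    : ORTerm (suc arity)
      params  : Fin arity → F
      eval    : ∀ x → evalOR R term (x ∷ params) ≡ f x
  open IsTerm

  isTerm-const : ∀ k → IsTerm (λ _ → k)
  isTerm-const k = record { arity = 1 ; term = var (suc zero) ; params = λ _ → k ; eval = λ _ → refl }

  isTerm-id : IsTerm (λ x → x)
  isTerm-id = record { arity = 0 ; term = var zero ; params = λ () ; eval = λ _ → refl }

  module _ {f g : F → F} (t : IsTerm f) (s : IsTerm g) where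
    private
      -- The argument, variable zero, is shared by both terms, while their parameters are placed
      -- side by side.
      left : Fin (suc (arity t)) → Fin (suc (arity t ℕ.+ arity s))
      left zero    = zero
      left (suc i) = suc (i ↑ˡ arity s)

      right : Fin (suc (arity s)) → Fin (suc (arity t ℕ.+ arity s))
      right zero    = zero
      right (suc i) = suc (arity t ↑ʳ i)

      joined : Fin (arity t ℕ.+ arity s) → F
      joined = params t ++ params s

      eval-left : ∀ x → evalOR R (renameOR left (term t)) (x ∷ joined) ≡ f x
      eval-left x = trans (evalOR-rename left (term t) λ { zero → refl ; (suc i) → lookup-++ˡ (params t) (params s) i }) (eval t x)

      eval-right : ∀ x → evalOR R (renameOR right (term s)) (x ∷ joined) ≡ g x
      eval-right x = trans (evalOR-rename right (term s) λ { zero → refl ; (suc i) → lookup-++ʳ (params t) (params s) i }) (eval s x)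

    isTerm-+ : IsTerm (λ x → f x + g x)
    isTerm-+ = record { term = renameOR left (term t) ⊕ renameOR right (term s) ; params = joined
                      ; eval = λ x → cong₂ _+_ (eval-left x) (eval-right x) }

    isTerm-* : IsTerm (λ x → f x * g x)
    isTerm-* = record { term = renameOR left (term t) ⊗ renameOR right (term s) ; params = joined
                      ; eval = λ x → cong₂ _*_ (eval-left x) (eval-right x) }

  isTerm-exp : ∀ {f} → IsTerm f → IsTerm (λ x → exp (f x))
  isTerm-exp t = record { term = exp' (term t) ; params = params t ; eval = λ x → cong exp (eval t x) }

  isTerm-scale : ∀ {f} k → IsTerm f → IsTerm (λ x → k * f x)
  isTerm-scale k = isTerm-* (isTerm-const k)

  opaque
    maximum : ∀ {f u v} → IsTerm f → u < v → ∃ λ z → (u ≤ z × z ≤ v) × (∀ x → u ≤ x → x ≤ v → f x ≤ f z)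
    maximum {f} {u} {v} t u<v with maxVal (arity t) (term t) (params t) u v u<v
    ... | z , z∈ , max = z , z∈ , λ x u≤x x≤v → subst₂ _≤_ (eval t x) (eval t z) (max x u≤x x≤v)

  -- The derivative of exp

  opaque
    -- The value e at 0 satisfies e · e = e, and e is positive, so e · (e - 1) = 0 can be cancelled.
    exp-zero : exp 0# ≡ 1#
    exp-zero = x-y≡0⇒x≡y (*-cancelˡ-zero (exp-pos 0#)
      (trans (solve 1 (λ e → e :* (e :- con (pos 1)) := e :* e :- e) refl (exp 0#))
        (trans (cong (_- exp 0#) (trans (sym (exp-hom 0# 0#)) (cong exp (+-identityˡ 0#)))) (-‿inverseʳ _))))

  opaque
    exp-neg : ∀ x → exp (- x) * exp x ≡ 1#
    exp-neg x = trans (sym (exp-hom (- x) x)) (trans (cong exp (solve 1 (λ x → :- x :+ x := con (pos 0)) refl x)) exp-zero)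

  opaque
    -- Otherwise squaring would give 2 = exp 1 ≥ (1 + ½)² = 2 + ½ · ½. This strict inequality is
    -- what forces the maximum of x - exp x into the interior of [0 , 1].
    exp-½<1+½ : exp ½ < 1# + ½
    exp-½<1+½ with <-≤-connex (exp ½) (1# + ½)
    ... | inj₁ p = p
    ... | inj₂ p = ⊥-elim (<⇒≱
      (<-from-difference (½ * ½) (*-pos _ _ 0<½ 0<½)
        (trans (cong (λ a → 1# + a + ½ * ½) (sym ½+½≡1))
          (solve 1 (λ h → con (pos 1) :+ (h :+ h) :+ h :* h := (con (pos 1) :+ h) :* (con (pos 1) :+ h)) refl ½)))
      (subst ((1# + ½) * (1# + ½) ≤_) (trans (sym (exp-hom ½ ½)) (trans (cong exp ½+½≡1) exp1))
        (≤-trans (*-monoˡ-≤ 0≤1+½ p) (*-monoʳ-≤ (inj₁ (exp-pos ½)) p))))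
      where
      0≤1+½ : 0# ≤ 1# + ½
      0≤1+½ = inj₁ (+-pos-≤ 0<1 (inj₁ 0<½))

  opaque
    -- x - exp x takes the value -1 at 0 and at 1 but exceeds it at ½, so its maximum z on
    -- [0, 1] is interior; the maximality of z is the tangent bound below with slope exp (- z).
    exp-tangent : ∃ λ c → 0# < c × ∃ λ δ → 0# < δ × (∀ h → Bounded h δ → 0# ≤ exp h - (1# + c * h))
    exp-tangent with maximum (isTerm-+ isTerm-id (isTerm-scale (- 1#) (isTerm-exp isTerm-id))) 0<1
    ... | z , (0≤z , z≤1) , max = exp (- z) , exp-pos (- z) , tangent (lower-bound 0<z (x<y⇒0<y-x z<1))
      where
      value : F → F
      value x = x + - 1# * exp x

      -1<value-z : - 1# < value z
      -1<value-z = <-≤-trans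
        (<-from-difference _ (x<y⇒0<y-x exp-½<1+½)
          (solve 2 (λ h e → :- con (pos 1) :+ (con (pos 1) :+ h :- e) := h :+ :- con (pos 1) :* e) refl ½ (exp ½)))
        (max ½ (inj₁ 0<½) (inj₁ (<-from-difference ½ 0<½ ½+½≡1)))

      value-0 : value 0# ≡ - 1#
      value-0 = trans (cong (λ e → 0# + - 1# * e) exp-zero) (solve 0 (con (pos 0) :+ :- con (pos 1) :* con (pos 1) := :- con (pos 1)) refl)

      value-1 : value 1# ≡ - 1#
      value-1 = trans (cong (λ e → 1# + - 1# * e) exp1) (solve 0 (con (pos 1) :+ :- con (pos 1) :* con (pos 2) := :- con (pos 1)) refl)

      0<z : 0# < z
      0<z = [ (λ p → p) , (λ { refl → ⊥-elim (<-irrefl (sym value-0) -1<value-z) }) ] 0≤z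

      z<1 : z < 1#
      z<1 = [ (λ p → p) , (λ { refl → ⊥-elim (<-irrefl (sym value-1) -1<value-z) }) ] z≤1

      tangent : (∃ λ δ → 0# < δ × δ ≤ z × δ ≤ 1# - z) →
        ∃ λ δ → 0# < δ × (∀ h → Bounded h δ → 0# ≤ exp h - (1# + exp (- z) * h))
      tangent (δ , 0<δ , δ≤z , δ≤1-z) = δ , 0<δ , λ h bh →
        subst (0# ≤_)
          (trans (cong (λ a → exp (- z) * (z + - 1# * exp z - (z + h + - 1# * a))) (exp-hom z h))
            (trans (solve 5 (λ c z h e a → c :* (z :+ :- con (pos 1) :* e :- (z :+ h :+ :- con (pos 1) :* (e :* a)))
                        := c :* e :* (a :- con (pos 1)) :- c :* h) refl (exp (- z)) z h (exp z) (exp h))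
              (trans (cong (λ b → b * (exp h - 1#) - exp (- z) * h) (exp-neg z))
                (solve 3 (λ c h a → con (pos 1) :* (a :- con (pos 1)) :- c :* h := a :- (con (pos 1) :+ c :* h)) refl (exp (- z)) h (exp h)))))
          (≤-* _ _ (inj₁ (exp-pos (- z))) (x≤y⇒0≤y-x (max (z + h)
            (proj₁ (bounded-mono δ≤z bh))
            (0≤y-x⇒x≤y (subst (0# ≤_) (solve 2 (λ z h → con (pos 1) :- z :- h := con (pos 1) :- (z :+ h)) refl z h)
              (proj₂ (bounded-mono δ≤1-z bh)))))))

  opaque
    -- The tangent bound says that the remainder r is nonnegative near 0. The same bound at -h,
    -- multiplied by exp h, gives r · (1 - c · h) ≤ c² · h². When c · h ≤ ½ the two together make r
    -- quadratically small.
    exp-differentiable-at-0 : ∃ λ c → HasDerivative exp 0# c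
    exp-differentiable-at-0 with exp-tangent
    ... | c , 0<c , δ₀ , 0<δ₀ , tangent = c , has-derivative r expansion littleO-r
      where
      r : F → F
      r h = exp h - (1# + c * h)

      expansion : ∀ h → exp (0# + h) ≡ exp 0# + (c * h + r h)
      expansion h = trans (cong exp (+-identityˡ h))
        (trans (solve 3 (λ c h e → e := con (pos 1) :+ (c :* h :+ (e :- (con (pos 1) :+ c :* h)))) refl c h (exp h))
          (cong (_+ (c * h + r h)) (sym exp-zero)))

      -- From exp h (1 - c h) ≤ exp h exp (- h) = 1.
      r-upper : ∀ h → Bounded h δ₀ → 0# ≤ c * c * (h * h) - r h * (1# - c * h)
      r-upper h (l , u) = subst (0# ≤_)
        (trans (solve 4 (λ c h a b → a :* (b :- (con (pos 1) :+ c :* :- h)) := b :* a :- a :* (con (pos 1) :- c :* h)) refl c h (exp h) (exp (- h)))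
          (trans (cong (_- exp h * (1# - c * h)) (exp-neg h))
            (solve 3 (λ c h a → con (pos 1) :- a :* (con (pos 1) :- c :* h) :=
              c :* c :* (h :* h) :- (a :- (con (pos 1) :+ c :* h)) :* (con (pos 1) :- c :* h)) refl c h (exp h))))
        (≤-* _ _ (inj₁ (exp-pos h)) (tangent (- h) (u , subst (0# ≤_) (solve 2 (λ d h → d :+ h := d :- (:- h)) refl δ₀ h) l)))

      littleO-r : LittleO r
      littleO-r η 0<η with inverse-pos 0<c
      ... | c⁻¹ , 0<c⁻¹ , cc⁻¹≡1
        -- The bound ½ / c makes c · h ≤ ½, and the bound ½ · η / c² makes c² · ρ² ≤ ½ · η · ρ.
        with lower-bound (*-pos _ _ 0<c⁻¹ 0<½) (*-pos _ _ (*-pos _ _ 0<c⁻¹ 0<c⁻¹) (0<½* 0<η))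
      ... | δ₁ , 0<δ₁ , δ₁≤ , δ₁≤′ with lower-bound 0<δ₀ 0<δ₁
      ... | δ , 0<δ , δ≤δ₀ , δ≤δ₁ = δ , 0<δ , bound
        where
        cancel : ∀ x → c * (c⁻¹ * x) ≡ x
        cancel x = trans (solve 3 (λ c d x → c :* (d :* x) := c :* d :* x) refl c c⁻¹ x) (trans (cong (_* x) cc⁻¹≡1) (*-identityˡ x))

        bound : ∀ ρ h → 0# ≤ ρ → ρ ≤ δ → Bounded h ρ → Bounded (r h) (η * ρ)
        bound ρ h 0≤ρ ρ≤δ bh = ≤-+ _ _ (≤-* _ _ (inj₁ 0<η) 0≤ρ) 0≤r ,
          *-cancelˡ-nonneg 0<½ (subst (0# ≤_) split
            (≤-+ _ _ (≤-+ _ _ (≤-+ _ _ quadratic (≤-* _ _ 0≤cc (proj₂ (bounded-* bh bh)))) (r-upper h bh₀)) (≤-* _ _ 0≤r 0≤½-ch)))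
          where
          bh₀ : Bounded h δ₀
          bh₀ = bounded-mono (≤-trans ρ≤δ δ≤δ₀) bh
          0≤r : 0# ≤ r h
          0≤r = tangent h bh₀
          0≤c : 0# ≤ c
          0≤c = inj₁ 0<c
          0≤cc : 0# ≤ c * c
          0≤cc = ≤-* _ _ 0≤c 0≤c
          ρ≤δ₁ : ρ ≤ δ₁
          ρ≤δ₁ = ≤-trans ρ≤δ δ≤δ₁
          0≤½-ch : 0# ≤ ½ - c * h
          0≤½-ch = proj₂ (bounded-mono (subst (c * ρ ≤_) (cancel ½) (*-monoˡ-≤ 0≤c (≤-trans ρ≤δ₁ δ₁≤)))
            (bounded-* (bounded-self 0≤c) bh))
          quadratic : 0# ≤ ½ * η * ρ - c * c * (ρ * ρ)
          quadratic = x≤y⇒0≤y-x (subst₂ _≤_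
            (solve 2 (λ c ρ → c :* c :* ρ :* ρ := c :* c :* (ρ :* ρ)) refl c ρ)
            (cong (_* ρ) (trans (solve 3 (λ c d x → c :* c :* (d :* d :* x) := c :* (d :* (c :* (d :* x)))) refl c c⁻¹ (½ * η))
              (trans (cancel _) (cancel _))))
            (*-monoʳ-≤ 0≤ρ (*-monoˡ-≤ 0≤cc (≤-trans ρ≤δ₁ δ₁≤′))))
          split : ½ * η * ρ - c * c * (ρ * ρ) + c * c * (ρ * ρ - h * h) + (c * c * (h * h) - r h * (1# - c * h)) + r h * (½ - c * h)
            ≡ ½ * (η * ρ - r h)
          split = trans (cong (λ a → ½ * η * ρ - c * c * (ρ * ρ) + c * c * (ρ * ρ - h * h) + (c * c * (h * h) - r h * (a - c * h)) + r h * (½ - c * h)) (sym ½+½≡1))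
            (solve 6 (λ k η ρ c h r → k :* η :* ρ :- c :* c :* (ρ :* ρ) :+ c :* c :* (ρ :* ρ :- h :* h)
                :+ (c :* c :* (h :* h) :- r :* (k :+ k :- c :* h)) :+ r :* (k :- c :* h) := k :* (η :* ρ :- r)) refl ½ η ρ c h (r h))

  -- Since exp 1 = 2, `exp` is exponentiation to base 2, whose derivative at 0 is classically the
  -- natural logarithm of 2.
  log2 : F
  log2 = proj₁ exp-differentiable-at-0

  opaque
    -- By the addition law the increment of exp (g x) at `z` is exp (g z) times an increment of
    -- `exp` at 0, so differentiability at 0 gives the chain rule everywhere.
    derivative-exp : ∀ {g z e} → HasDerivative g z e → HasDerivative (λ x → exp (g x)) z (exp (g z) * (log2 * e))
    derivative-exp {g} {z} {e} (has-derivative s q os) with exp-differentiable-at-0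
    ... | c , has-derivative t p ot = has-derivative
      (λ h → exp (g z) * (c * s h + t (e * h + s h)))
      (λ h → trans (cong exp (q h)) (trans (exp-hom _ _)
        (trans (cong (exp (g z) *_) (trans (cong exp (sym (+-identityˡ _))) (trans (p _) (cong (_+ (c * (e * h + s h) + t (e * h + s h))) exp-zero))))
          (solve 6 (λ E c e h s t → E :* (con (pos 1) :+ (c :* (e :* h :+ s) :+ t)) := E :+ (E :* (c :* e) :* h :+ E :* (c :* s :+ t))) refl
            (exp (g z)) c e h (s h) (t (e * h + s h))))))
      (littleO-scale (exp (g z)) (littleO-+ (littleO-scale c os) (littleO-∘-bigO ot (bigO-+-littleO e os))))

-- Splitting points need not lie inside the interval, which makes restriction to subintervals trivial.
data Piecewise {F : Set} (C : F → F → Set) : F → F → Set where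
  piece : ∀ {p q} → C p q → Piecewise C p q
  split : ∀ {p q} r → Piecewise C p r → Piecewise C r q → Piecewise C p q

piecewise-bind : ∀ {F : Set} {C D : F → F → Set} → (∀ {p q} → C p q → Piecewise D p q) →
  ∀ {p q} → Piecewise C p q → Piecewise D p q
piecewise-bind f (piece c)     = f c
piecewise-bind f (split r a b) = split r (piecewise-bind f a) (piecewise-bind f b)

piecewise-map : ∀ {F : Set} {C D : F → F → Set} → (∀ {p q} → C p q → D p q) →
  ∀ {p q} → Piecewise C p q → Piecewise D p q
piecewise-map f = piecewise-bind (λ c → piece (f c))

-- Rolle's theorem, monotonicity and sign changes.

module SignChanges (R : ExpField) (maxVal : MaxVal R)
  (exp1 : ExpField.exp R (ExpField.1# R) ≡ ExpField._+_ R (ExpField.1# R) (ExpField.1# R)) where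
  open MaxValProperties R maxVal exp1 public

  interior-or-end : ∀ {u v z} (g : F → F) → g u ≡ g v → u ≤ z → z ≤ v → (u < z × z < v) ⊎ g z ≡ g u
  interior-or-end g gu≡gv (inj₁ p) (inj₁ q) = inj₁ (p , q)
  interior-or-end g gu≡gv (inj₂ refl) _ = inj₂ refl
  interior-or-end g gu≡gv (inj₁ _) (inj₂ refl) = inj₂ (sym gu≡gv)

  neg-≤⇒≥ : ∀ {x y} → - 1# * x ≤ - 1# * y → y ≤ x
  neg-≤⇒≥ {x} {y} p = 0≤y-x⇒x≤y (subst (0# ≤_)
    (solve 2 (λ x y → :- con (pos 1) :* y :- :- con (pos 1) :* x := x :- y) refl x y) (x≤y⇒0≤y-x p))

  neg≡0⇒≡0 : ∀ {x} → - 1# * x ≡ 0# → x ≡ 0#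
  neg≡0⇒≡0 {x} p = trans (solve 1 (λ x → x := :- con (pos 1) :* (:- con (pos 1) :* x)) refl x) (trans (cong (- 1# *_) p) (zeroʳ _))

  opaque
    rolle : ∀ {g g′ : F → F} {u v} → IsTerm g → (∀ z → HasDerivative g z (g′ z)) → u < v → g u ≡ g v →
      ∃ λ w → u < w × w < v × g′ w ≡ 0#
    rolle {g} {g′} {u} {v} t dg u<v gu≡gv with maximum t u<v
    ... | z , (u≤z , z≤v) , max with interior-or-end g gu≡gv u≤z z≤v
    ... | inj₁ (u<z , z<v) = z , u<z , z<v , interior-maximum (dg z) u<z z<v max
    ... | inj₂ gz≡gu with maximum (isTerm-scale (- 1#) t) u<v
    ... | y , (u≤y , y≤v) , min with interior-or-end g gu≡gv u≤y y≤v
    ... | inj₁ (u<y , y<v) = y , u<y , y<v , neg≡0⇒≡0 (interior-maximum (derivative-scale (- 1#) (dg y)) u<y y<v min)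
    -- Maximum and minimum both equal the common value at the ends, so `g` is constant on [u , v]
    -- and any interior point is a maximum.
    ... | inj₂ gy≡gu = midpoint u v , u<m , m<v , interior-maximum (dg _) u<m m<v
        λ x u≤x x≤v → ≤-trans (subst (g x ≤_) (trans gz≡gu (sym gy≡gu)) (max x u≤x x≤v)) (neg-≤⇒≥ (min _ (inj₁ u<m) (inj₁ m<v)))
      where
      u<m : u < midpoint u v
      u<m = u<midpoint u<v
      m<v : midpoint u v < v
      m<v = midpoint<v u<v

  opaque
    -- Rolle's theorem for (v - u) · f x - (f v - f u) · x, which takes equal values at `u` and `v`.
    -- Keeping the factor v - u avoids division.
    mean-value : ∀ {f f′ : F → F} {u v} → IsTerm f → (∀ z → HasDerivative f z (f′ z)) → u < v →
      ∃ λ w → u < w × w < v × (v - u) * f′ w ≡ f v - f u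
    mean-value {f} {f′} {u} {v} t df u<v = conclude (rolle
      (isTerm-+ (isTerm-scale (v - u) t) (isTerm-scale (- (f v - f u)) isTerm-id))
      (λ z → derivative-+ (derivative-scale (v - u) (df z)) (derivative-scale (- (f v - f u)) (derivative-id z)))
      u<v
      (solve 4 (λ u v a b → (v :- u) :* a :+ :- (b :- a) :* u := (v :- u) :* b :+ :- (b :- a) :* v) refl u v (f u) (f v)))
      where
      conclude : (∃ λ w → u < w × w < v × (v - u) * f′ w + - (f v - f u) * 1# ≡ 0#) →
        ∃ λ w → u < w × w < v × (v - u) * f′ w ≡ f v - f u
      conclude (w , u<w , w<v , e) = w , u<w , w<v ,
        x-y≡0⇒x≡y (trans (solve 2 (λ a b → a :- b := a :+ :- b :* con (pos 1)) refl _ (f v - f u)) e)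

  StrictlyIncreasingOn : (F → F) → F → F → Set
  StrictlyIncreasingOn f p q = ∀ u v → p ≤ u → u < v → v ≤ q → f u < f v

  opaque
    increasing : ∀ {f f′ : F → F} {p q} → IsTerm f → (∀ z → HasDerivative f z (f′ z)) → (∀ z → p < z → z < q → 0# < f′ z) →
      StrictlyIncreasingOn f p q
    increasing t df pos′ u v p≤u u<v v≤q with mean-value t df u<v
    ... | w , u<w , w<v , e = 0<y-x⇒x<y (subst (0# <_) e
      (*-pos _ _ (x<y⇒0<y-x u<v) (pos′ w (≤-<-trans p≤u u<w) (<-≤-trans w<v v≤q))))

  opaque
    constant : ∀ {f f′ : F → F} {p q} → IsTerm f → (∀ z → HasDerivative f z (f′ z)) → (∀ z → p < z → z < q → f′ z ≡ 0#) →
      ∀ z → p < z → z < q → f z ≡ f p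
    constant t df zero′ z p<z z<q with mean-value t df p<z
    ... | w , p<w , w<z , e = x-y≡0⇒x≡y (trans (sym e) (trans (cong (_ *_) (zero′ w p<w (<-trans w<z z<q))) (zeroʳ _)))

  square-mono-< : ∀ {x y} → 0# < x → x < y → x * x < y * y
  square-mono-< {x} {y} p q = <-from-difference ((y - x) * (y + x))
    (*-pos _ _ (x<y⇒0<y-x q) (+-pos-≤ (<-trans p q) (inj₁ p)))
    (solve 2 (λ x y → x :* x :+ (y :- x) :* (y :+ x) := y :* y) refl x y)

  square-anti-< : ∀ {x y} → x < y → y < 0# → y * y < x * x
  square-anti-< {x} {y} p q = subst₂ _<_ (neg-square y) (neg-square x)
    (square-mono-< (x<0⇒0<-x q) (0<y-x⇒x<y (subst (0# <_) (solve 2 (λ x y → y :- x := :- x :- :- y) refl x y) (x<y⇒0<y-x p))))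
    where
    neg-square : ∀ a → - a * - a ≡ a * a
    neg-square = solve 1 (λ a → :- a :* :- a := a :* a) refl

  -- The zero is the point where f² is minimal: by continuity and strict monotonicity
  -- f² can be decreased near every other point of [p , q].
  opaque
    increasing-zero : ∀ {f f′ : F → F} {p q} → IsTerm f → (∀ z → HasDerivative f z (f′ z)) → StrictlyIncreasingOn f p q →
      p < q → f p < 0# → 0# < f q → ∃ λ r → f r ≡ 0# × p < r × r < q
    increasing-zero {f} {f′} {p} {q} t df inc p<q fp<0 0<fq with maximum (isTerm-scale (- 1#) (isTerm-* t t)) p<q
    ... | r , (p≤r , r≤q) , min = conclude p≤r r≤q (compare (f r) 0#)
      where
      conclude : p ≤ r → r ≤ q → Tri (f r < 0#) (f r ≡ 0#) (0# < f r) → ∃ λ r → f r ≡ 0# × p < r × r < q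
      conclude p≤r r≤q (tri≈ _ fr≡0 _) = r , fr≡0 ,
        [ (λ p<r → p<r) , (λ { refl → ⊥-elim (<-irrefl fr≡0 fp<0) }) ] p≤r ,
        [ (λ r<q → r<q) , (λ { refl → ⊥-elim (<-irrefl (sym fr≡0) 0<fq) }) ] r≤q
      conclude (inj₂ refl) _ (tri> _ _ 0<fr) = ⊥-elim (<⇒≱ 0<fr (inj₁ fp<0))
      conclude (inj₁ p<r) r≤q (tri> _ _ 0<fr) with positive-nearby (df r) 0<fr
      ... | δ , 0<δ , near with lower-bound 0<δ (x<y⇒0<y-x p<r)
      ... | ρ , 0<ρ , ρ≤δ , ρ≤r-p = ⊥-elim (<⇒≱
          (square-mono-< (near (- ρ) (bounded-mono ρ≤δ bounded-neg)) (inc (r + - ρ) r p≤s s<r r≤q))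
          (neg-≤⇒≥ (min (r + - ρ) p≤s (inj₁ (<-≤-trans s<r r≤q)))))
        where
        bounded-neg : Bounded (- ρ) ρ
        bounded-neg = inj₂ (sym (-‿inverseʳ ρ)) , subst (0# ≤_) (solve 1 (λ ρ → ρ :+ ρ := ρ :- :- ρ) refl ρ) (≤-+ _ _ (inj₁ 0<ρ) (inj₁ 0<ρ))
        p≤s : p ≤ r + - ρ
        p≤s = ≤-from-difference _ (x≤y⇒0≤y-x ρ≤r-p) (solve 3 (λ p r ρ → p :+ (r :- p :- ρ) := r :+ :- ρ) refl p r ρ)
        s<r : r + - ρ < r
        s<r = <-from-difference ρ 0<ρ (solve 2 (λ r ρ → r :+ :- ρ :+ ρ := r) refl r ρ)
      conclude _ (inj₂ refl) (tri< fr<0 _ _) = ⊥-elim (<⇒≱ 0<fq (inj₁ fr<0))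
      conclude p≤r (inj₁ r<q) (tri< fr<0 _ _) with positive-nearby (derivative-scale (- 1#) (df r)) 0<-fr
        where
        0<-fr : 0# < - 1# * f r
        0<-fr = subst (0# <_) (solve 1 (λ a → :- a := :- con (pos 1) :* a) refl (f r)) (x<0⇒0<-x fr<0)
      ... | δ , 0<δ , near with lower-bound 0<δ (x<y⇒0<y-x r<q)
      ... | ρ , 0<ρ , ρ≤δ , ρ≤q-r = ⊥-elim (<⇒≱
          (square-anti-< (inc r (r + ρ) p≤r r<s s≤q)
            (0<-x⇒x<0 (subst (0# <_) (solve 1 (λ a → :- con (pos 1) :* a := :- a) refl (f (r + ρ)))
              (near ρ (bounded-mono ρ≤δ (bounded-self (inj₁ 0<ρ)))))))
          (neg-≤⇒≥ (min (r + ρ) (≤-trans p≤r (inj₁ r<s)) s≤q)))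
        where
        r<s : r < r + ρ
        r<s = pos⇒x<x+y 0<ρ
        s≤q : r + ρ ≤ q
        s≤q = ≤-from-difference _ (x≤y⇒0≤y-x ρ≤q-r) (solve 3 (λ r q ρ → r :+ ρ :+ (q :- r :- ρ) := q) refl r q ρ)

  -- Only the open interval matters: values at break points are left unspecified, and an empty
  -- interval has every sign.
  ConstantSign : (F → F) → F → F → Set
  ConstantSign f p q = (∀ z → p < z → z < q → f z < 0#)
                     ⊎ (∀ z → p < z → z < q → f z ≡ 0#)
                     ⊎ (∀ z → p < z → z < q → 0# < f z)

  FinitelyManySignChanges : (F → F) → Set
  FinitelyManySignChanges f = ∀ p q → Piecewise (ConstantSign f) p q

  -- Besides removing exponential factors, this serves with the constant factor 1 as transport along
  -- pointwise equality.
  constantSign-scale : ∀ {f g} (m : F → F) → (∀ x → 0# < m x) → (∀ x → g x ≡ m x * f x) →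
    ∀ {p q} → ConstantSign f p q → ConstantSign g p q
  constantSign-scale {f} m 0<m e (inj₁ n) = inj₁ λ z a b → 0<-x⇒x<0 (subst (0# <_)
    (trans (solve 2 (λ m f → m :* :- f := :- (m :* f)) refl (m z) (f z)) (cong -_ (sym (e z))))
    (*-pos _ _ (0<m z) (x<0⇒0<-x (n z a b))))
  constantSign-scale m 0<m e (inj₂ (inj₁ n)) = inj₂ (inj₁ λ z a b → trans (e z) (trans (cong (m z *_) (n z a b)) (zeroʳ _)))
  constantSign-scale m 0<m e (inj₂ (inj₂ n)) = inj₂ (inj₂ λ z a b → subst (0# <_) (sym (e z)) (*-pos _ _ (0<m z) (n z a b)))

  constantSign-neg : ∀ {f p q} → ConstantSign (λ x → - 1# * f x) p q → ConstantSign f p q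
  constantSign-neg {f} (inj₁ n) = inj₂ (inj₂ λ z a b → subst (0# <_)
    (solve 1 (λ f → :- (:- con (pos 1) :* f) := f) refl (f z)) (x<0⇒0<-x (n z a b)))
  constantSign-neg (inj₂ (inj₁ n)) = inj₂ (inj₁ λ z a b → neg≡0⇒≡0 (n z a b))
  constantSign-neg {f} (inj₂ (inj₂ n)) = inj₁ λ z a b → 0<-x⇒x<0 (subst (0# <_)
    (solve 1 (λ f → :- con (pos 1) :* f := :- f) refl (f z)) (n z a b))

  opaque
    -- A new break point arises only if `f` is negative at `p` and positive at `q`; it is then the
    -- unique zero between them.
    increasing-sign : ∀ {f f′ : F → F} {p q} → IsTerm f → (∀ z → HasDerivative f z (f′ z)) → p < q →
      (∀ z → p < z → z < q → 0# < f′ z) → Piecewise (ConstantSign f) p q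
    increasing-sign {f} {f′} {p} {q} t df p<q 0<f′ with <-≤-connex (f p) 0# | <-≤-connex 0# (f q)
    ... | inj₂ 0≤fp | _ = piece (inj₂ (inj₂ λ z a b → ≤-<-trans 0≤fp (increasing t df 0<f′ p z ≤-refl a (inj₁ b))))
    ... | inj₁ _ | inj₂ fq≤0 = piece (inj₁ λ z a b → <-≤-trans (increasing t df 0<f′ z q (inj₁ a) b ≤-refl) fq≤0)
    ... | inj₁ fp<0 | inj₁ 0<fq with increasing-zero t df (increasing t df 0<f′) p<q fp<0 0<fq
    ... | r , fr≡0 , p<r , r<q = split r
      (piece (inj₁ λ z a b → subst (f z <_) fr≡0 (increasing t df 0<f′ z r (inj₁ a) b (inj₁ r<q))))
      (piece (inj₂ (inj₂ λ z a b → subst (_< f z) fr≡0 (increasing t df 0<f′ r z (inj₁ p<r) a (inj₁ b)))))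

  opaque
    constant-sign : ∀ {f p q} k → (∀ z → p < z → z < q → f z ≡ k) → ConstantSign f p q
    constant-sign k e with compare k 0#
    ... | tri< n _ _ = inj₁ λ z a b → subst (_< 0#) (sym (e z a b)) n
    ... | tri≈ _ n _ = inj₂ (inj₁ λ z a b → trans (e z a b) n)
    ... | tri> _ _ n = inj₂ (inj₂ λ z a b → subst (0# <_) (sym (e z a b)) n)

  opaque
    -- On each piece for `f′` the function `f` is strictly monotone or constant, so the piece needs
    -- at most one further break point.
    antiderivative-sign : ∀ {f f′ : F → F} → IsTerm f → (∀ z → HasDerivative f z (f′ z)) →
      FinitelyManySignChanges f′ → FinitelyManySignChanges f
    antiderivative-sign {f} {f′} t df f′-sign p q = piecewise-bind integrate (f′-sign p q)
      where
      integrate : ∀ {p q} → ConstantSign f′ p q → Piecewise (ConstantSign f) p q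
      integrate {p} {q} c with <-≤-connex p q
      ... | inj₂ q≤p = piece (inj₁ λ z p<z z<q → ⊥-elim (<⇒≱ (<-trans p<z z<q) q≤p))
      -- Decreasing functions are handled by passing to the negative of `f`.
      integrate {p} {q} (inj₁ n) | inj₁ p<q = piecewise-map constantSign-neg
        (increasing-sign (isTerm-scale (- 1#) t) (λ z → derivative-scale (- 1#) (df z)) p<q
          λ z a b → subst (0# <_) (solve 1 (λ f → :- f := :- con (pos 1) :* f) refl (f′ z)) (x<0⇒0<-x (n z a b)))
      integrate {p} {q} (inj₂ (inj₁ n)) | inj₁ p<q = piece (constant-sign (f p) (constant t df n))
      integrate {p} {q} (inj₂ (inj₂ n)) | inj₁ p<q = increasing-sign t df p<q n

-- Rings of functions closed under differentiation, and reducibility.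

module ExponentialPolynomials (R : ExpField) (maxVal : MaxVal R)
  (exp1 : ExpField.exp R (ExpField.1# R) ≡ ExpField._+_ R (ExpField.1# R) (ExpField.1# R)) where
  open import Data.List using (List; []; _∷_; map; length) renaming (_++_ to _⧺_)
  open import Data.List.Properties using (length-map)
  open SignChanges R maxVal exp1 public

  -- The carrier consists of formal expressions. Ring laws are not imposed on them; only evaluation
  -- has to respect the operations, as all later arguments are pointwise.
  record FunctionRing : Set₁ where
    infixl 6 _⊞_
    infixl 7 _⊠_
    field
      Carrier    : Set
      ⟦_⟧        : Carrier → F → F
      isTerm     : ∀ a → IsTerm ⟦ a ⟧
      D          : Carrier → Carrier
      derivative : ∀ a z → HasDerivative ⟦ a ⟧ z (⟦ D a ⟧ z)
      const      : F → Carrier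
      _⊞_ _⊠_    : Carrier → Carrier → Carrier
      ⟦const⟧    : ∀ k x → ⟦ const k ⟧ x ≡ k
      ⟦⊞⟧        : ∀ a b x → ⟦ a ⊞ b ⟧ x ≡ ⟦ a ⟧ x + ⟦ b ⟧ x
      ⟦⊠⟧        : ∀ a b x → ⟦ a ⊠ b ⟧ x ≡ ⟦ a ⟧ x * ⟦ b ⟧ x

    -- If m is the derivative of h then exp h · twist m a is the derivative of exp h · a.
    twist : Carrier → Carrier → Carrier
    twist m a = D a ⊞ const log2 ⊠ m ⊠ a

    ⟦twist⟧ : ∀ m a x → ⟦ twist m a ⟧ x ≡ ⟦ D a ⟧ x + log2 * ⟦ m ⟧ x * ⟦ a ⟧ x
    ⟦twist⟧ m a x = trans (⟦⊞⟧ _ _ x) (cong (⟦ D a ⟧ x +_)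
      (trans (⟦⊠⟧ _ _ x) (cong (_* ⟦ a ⟧ x) (trans (⟦⊠⟧ _ _ x) (cong (_* ⟦ m ⟧ x) (⟦const⟧ log2 x))))))

  -- Elements which can be brought to 0 by repeatedly multiplying with an exponential,
  -- differentiating and dropping the exponential factor again.
  data Reducible (L : FunctionRing) : FunctionRing.Carrier L → Set where
    vanishing : ∀ {a} → (∀ x → FunctionRing.⟦_⟧ L a x ≡ 0#) → Reducible L a
    equal     : ∀ {a} b → (∀ x → FunctionRing.⟦_⟧ L a x ≡ FunctionRing.⟦_⟧ L b x) → Reducible L b → Reducible L a
    step      : ∀ {a} {h : F → F} (m b : FunctionRing.Carrier L) → IsTerm h →
                (∀ z → HasDerivative h z (FunctionRing.⟦_⟧ L m z)) →
                (∀ x → FunctionRing.⟦_⟧ L b x ≡ FunctionRing.⟦_⟧ L (FunctionRing.twist L m a) x) →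
                Reducible L b → Reducible L a

  module _ (L : FunctionRing) where
    open FunctionRing L

    -- In a `step`, exp h · a has derivative exp h · b. Sign changes pass from b to exp h · b, by
    -- integration to exp h · a, and after multiplication by exp (- h) to a.
    reducible-sign : ∀ {a} → Reducible L a → FinitelyManySignChanges ⟦ a ⟧
    reducible-sign (vanishing a≡0) p q = piece (constant-sign 0# λ z _ _ → a≡0 z)
    reducible-sign (equal b a≡b r) p q = piecewise-map
      (constantSign-scale (λ _ → 1#) (λ _ → 0<1) (λ x → trans (a≡b x) (sym (*-identityˡ _)))) (reducible-sign r p q)
    reducible-sign {a} (step {h = h} m b th dh b≡ r) p q = piecewise-map
      (constantSign-scale (λ x → exp (- h x)) (λ x → exp-pos _) λ x →
        trans (sym (*-identityˡ _)) (trans (cong (_* ⟦ a ⟧ x) (sym (exp-neg (h x))))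
          (solve 3 (λ e f a → e :* f :* a := e :* (f :* a)) refl (exp (- h x)) (exp (h x)) (⟦ a ⟧ x))))
      (antiderivative-sign (isTerm-* (isTerm-exp th) (isTerm a))
        (λ z → derivative-* (derivative-exp (dh z)) (derivative a z))
        (λ p q → piecewise-map (constantSign-scale (λ x → exp (h x)) (λ x → exp-pos _) λ x →
          trans (solve 5 (λ e c m a d → e :* (c :* m) :* a :+ e :* d := e :* (d :+ c :* m :* a)) refl
              (exp (h x)) log2 (⟦ m ⟧ x) (⟦ a ⟧ x) (⟦ D a ⟧ x))
            (cong (exp (h x) *_) (sym (trans (b≡ x) (⟦twist⟧ m a x)))))
          (reducible-sign r p q))
        p q)

  -- Polynomials, the bottom level.

  module Polynomial where
    ⟦_⟧ : List F → F → F
    ⟦ [] ⟧    x = 0#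
    ⟦ k ∷ p ⟧ x = k + x * ⟦ p ⟧ x

    isTerm : ∀ p → IsTerm ⟦ p ⟧
    isTerm []      = isTerm-const 0#
    isTerm (k ∷ p) = isTerm-+ (isTerm-const k) (isTerm-* isTerm-id (isTerm p))

    -- Coefficients are listed from the constant term upwards, and the one of degree i is multiplied
    -- by n + i. The result is n · p + x · p′, which for n = 1 is the derivative of x · p.
    weighted : F → List F → List F
    weighted n []      = []
    weighted n (k ∷ p) = n * k ∷ weighted (n + 1#) p

    D : List F → List F
    D []      = []
    D (k ∷ p) = weighted 1# p

    ⟦weighted⟧ : ∀ n p x → ⟦ weighted n p ⟧ x ≡ n * ⟦ p ⟧ x + x * ⟦ D p ⟧ x
    ⟦weighted⟧ n []      x = solve 2 (λ n x → con (pos 0) := n :* con (pos 0) :+ x :* con (pos 0)) refl n x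
    ⟦weighted⟧ n (k ∷ p) x = trans (cong (λ a → n * k + x * a) (⟦weighted⟧ (n + 1#) p x))
      (trans (solve 5 (λ n k x p d → n :* k :+ x :* ((n :+ con (pos 1)) :* p :+ x :* d)
               := n :* (k :+ x :* p) :+ x :* (con (pos 1) :* p :+ x :* d)) refl n k x (⟦ p ⟧ x) (⟦ D p ⟧ x))
        (cong (λ a → n * (k + x * ⟦ p ⟧ x) + x * a) (sym (⟦weighted⟧ 1# p x))))

    derivative : ∀ p z → HasDerivative ⟦ p ⟧ z (⟦ D p ⟧ z)
    derivative []      z = derivative-const 0# z
    derivative (k ∷ p) z = subst (HasDerivative _ z)
      (trans (+-identityˡ _) (sym (⟦weighted⟧ 1# p z)))
      (derivative-+ (derivative-const k z) (derivative-* (derivative-id z) (derivative p z)))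

    infixl 6 _⊞_
    infixl 7 _⊠_
    _⊞_ _⊠_ : List F → List F → List F
    []      ⊞ q       = q
    (k ∷ p) ⊞ []      = k ∷ p
    (k ∷ p) ⊞ (l ∷ q) = k + l ∷ p ⊞ q
    []      ⊠ q       = []
    (k ∷ p) ⊠ q       = map (k *_) q ⊞ (0# ∷ p ⊠ q)

    ⟦⊞⟧ : ∀ p q x → ⟦ p ⊞ q ⟧ x ≡ ⟦ p ⟧ x + ⟦ q ⟧ x
    ⟦⊞⟧ []      q       x = sym (+-identityˡ _)
    ⟦⊞⟧ (k ∷ p) []      x = sym (+-identityʳ _)
    ⟦⊞⟧ (k ∷ p) (l ∷ q) x = trans (cong (λ a → k + l + x * a) (⟦⊞⟧ p q x))
      (solve 5 (λ k l x p q → k :+ l :+ x :* (p :+ q) := k :+ x :* p :+ (l :+ x :* q)) refl k l x (⟦ p ⟧ x) (⟦ q ⟧ x))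

    ⟦scale⟧ : ∀ k q x → ⟦ map (k *_) q ⟧ x ≡ k * ⟦ q ⟧ x
    ⟦scale⟧ k []      x = sym (zeroʳ k)
    ⟦scale⟧ k (l ∷ q) x = trans (cong (λ a → k * l + x * a) (⟦scale⟧ k q x))
      (solve 4 (λ k l x q → k :* l :+ x :* (k :* q) := k :* (l :+ x :* q)) refl k l x (⟦ q ⟧ x))

    ⟦⊠⟧ : ∀ p q x → ⟦ p ⊠ q ⟧ x ≡ ⟦ p ⟧ x * ⟦ q ⟧ x
    ⟦⊠⟧ []      q x = sym (zeroˡ _)
    ⟦⊠⟧ (k ∷ p) q x = trans (⟦⊞⟧ (map (k *_) q) (0# ∷ p ⊠ q) x)
      (trans (cong₂ (λ a b → a + (0# + x * b)) (⟦scale⟧ k q x) (⟦⊠⟧ p q x))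
        (solve 4 (λ k x p q → k :* q :+ (con (pos 0) :+ x :* (p :* q)) := (k :+ x :* p) :* q) refl k x (⟦ p ⟧ x) (⟦ q ⟧ x)))

    ring : FunctionRing
    ring = record
      { Carrier = List F ; ⟦_⟧ = ⟦_⟧ ; isTerm = isTerm ; D = D ; derivative = derivative
      ; const = _∷ [] ; _⊞_ = _⊞_ ; _⊠_ = _⊠_
      ; ⟦const⟧ = λ k x → trans (cong (k +_) (zeroʳ x)) (+-identityʳ k) ; ⟦⊞⟧ = ⟦⊞⟧ ; ⟦⊠⟧ = ⟦⊠⟧ }

    length-weighted : ∀ n p → length (weighted n p) ≡ length p
    length-weighted n []      = refl
    length-weighted n (k ∷ p) = cong suc (length-weighted (n + 1#) p)

    -- Steps with h = 0 are plain differentiation, and each removes one coefficient.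
    reducible-of-length : ∀ n p → length p ≡ n → Reducible ring p
    reducible-of-length _       []      _    = vanishing (λ _ → refl)
    reducible-of-length (suc n) (k ∷ p) e    = step [] (weighted 1# p) (isTerm-const 0#) (derivative-const 0#)
      (λ x → sym (trans (FunctionRing.⟦twist⟧ ring [] (k ∷ p) x)
        (solve 3 (λ w c a → w :+ c :* con (pos 0) :* a := w) refl (⟦ weighted 1# p ⟧ x) log2 (⟦ k ∷ p ⟧ x))))
      (reducible-of-length n (weighted 1# p) (trans (length-weighted 1# p) (ℕₚ.suc-injective e)))

    reducible : ∀ p → Reducible ring p
    reducible p = reducible-of-length _ p refl

  -- Sums of exponentials over a reducible ring.

  module ExponentialSum (L : FunctionRing) (reducibleᴸ : ∀ a → Reducible L a) where
    private module L = FunctionRing L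

    -- The list of the pairs (a , g) stands for the sum of the a · exp g.
    Sum : Set
    Sum = List (L.Carrier × L.Carrier)

    ⟦_⟧ : Sum → F → F
    ⟦ [] ⟧          x = 0#
    ⟦ (a , g) ∷ s ⟧ x = L.⟦ a ⟧ x * exp (L.⟦ g ⟧ x) + ⟦ s ⟧ x

    isTerm : ∀ s → IsTerm ⟦ s ⟧
    isTerm []            = isTerm-const 0#
    isTerm ((a , g) ∷ s) = isTerm-+ (isTerm-* (L.isTerm a) (isTerm-exp (L.isTerm g))) (isTerm s)

    D : Sum → Sum
    D = map λ (a , g) → L.twist (L.D g) a , g

    derivative : ∀ s z → HasDerivative ⟦ s ⟧ z (⟦ D s ⟧ z)
    derivative []            z = derivative-const 0# z
    derivative ((a , g) ∷ s) z = subst (HasDerivative _ z)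
      (cong (_+ ⟦ D s ⟧ z) (trans
        (solve 5 (λ d e a c g → d :* e :+ a :* (e :* (c :* g)) := (d :+ c :* g :* a) :* e) refl
          (L.⟦ L.D a ⟧ z) (exp (L.⟦ g ⟧ z)) (L.⟦ a ⟧ z) log2 (L.⟦ L.D g ⟧ z))
        (cong (_* exp (L.⟦ g ⟧ z)) (sym (L.⟦twist⟧ (L.D g) a z)))))
      (derivative-+ (derivative-* (L.derivative a z) (derivative-exp (L.derivative g z))) (derivative s z))

    embed : L.Carrier → Sum
    embed a = (a , L.const 0#) ∷ []

    ⟦embed⟧ : ∀ a x → ⟦ embed a ⟧ x ≡ L.⟦ a ⟧ x
    ⟦embed⟧ a x = trans (+-identityʳ _) (trans (cong (λ e → L.⟦ a ⟧ x * e) (trans (cong exp (L.⟦const⟧ 0# x)) exp-zero)) (*-identityʳ _))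

    exponential : L.Carrier → Sum
    exponential g = (L.const 1# , g) ∷ []

    ⟦exponential⟧ : ∀ g x → ⟦ exponential g ⟧ x ≡ exp (L.⟦ g ⟧ x)
    ⟦exponential⟧ g x = trans (+-identityʳ _) (trans (cong (_* exp (L.⟦ g ⟧ x)) (L.⟦const⟧ 1# x)) (*-identityˡ _))

    times : L.Carrier × L.Carrier → Sum → Sum
    times (a , g) = map λ (b , h) → a L.⊠ b , g L.⊞ h

    infixl 7 _⊠_
    _⊠_ : Sum → Sum → Sum
    []      ⊠ t = []
    (m ∷ s) ⊠ t = times m t ⧺ s ⊠ t

    ⟦⧺⟧ : ∀ s t x → ⟦ s ⧺ t ⟧ x ≡ ⟦ s ⟧ x + ⟦ t ⟧ x
    ⟦⧺⟧ []      t x = sym (+-identityˡ _)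
    ⟦⧺⟧ (m ∷ s) t x = trans (cong (_ +_) (⟦⧺⟧ s t x)) (sym (+-assoc _ _ _))

    ⟦times⟧ : ∀ a g t x → ⟦ times (a , g) t ⟧ x ≡ L.⟦ a ⟧ x * exp (L.⟦ g ⟧ x) * ⟦ t ⟧ x
    ⟦times⟧ a g []            x = sym (zeroʳ _)
    ⟦times⟧ a g ((b , h) ∷ t) x = trans
      (cong₂ _+_ (cong₂ _*_ (L.⟦⊠⟧ a b x) (trans (cong exp (L.⟦⊞⟧ g h x)) (exp-hom _ _))) (⟦times⟧ a g t x))
      (solve 5 (λ a e b f t → a :* b :* (e :* f) :+ a :* e :* t := a :* e :* (b :* f :+ t)) refl
        (L.⟦ a ⟧ x) (exp (L.⟦ g ⟧ x)) (L.⟦ b ⟧ x) (exp (L.⟦ h ⟧ x)) (⟦ t ⟧ x))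

    ⟦⊠⟧ : ∀ s t x → ⟦ s ⊠ t ⟧ x ≡ ⟦ s ⟧ x * ⟦ t ⟧ x
    ⟦⊠⟧ []            t x = sym (zeroˡ _)
    ⟦⊠⟧ ((a , g) ∷ s) t x = trans (⟦⧺⟧ (times (a , g) t) (s ⊠ t) x)
      (trans (cong₂ _+_ (⟦times⟧ a g t x) (⟦⊠⟧ s t x))
        (solve 3 (λ m s t → m :* t :+ s :* t := (m :+ s) :* t) refl _ (⟦ s ⟧ x) (⟦ t ⟧ x)))

    ring : FunctionRing
    ring = record
      { Carrier = Sum ; ⟦_⟧ = ⟦_⟧ ; isTerm = isTerm ; D = D ; derivative = derivative
      ; const = λ k → embed (L.const k) ; _⊞_ = _⧺_ ; _⊠_ = _⊠_
      ; ⟦const⟧ = λ k x → trans (⟦embed⟧ _ x) (L.⟦const⟧ k x) ; ⟦⊞⟧ = ⟦⧺⟧ ; ⟦⊠⟧ = ⟦⊠⟧ }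

    open FunctionRing ring using (twist; ⟦twist⟧)

    -- The general `twist` by `embed m` concatenates two sums and so doubles the number of summands.
    -- Absorbing `m` into the coefficients gives the same function and preserves the length, on
    -- which the induction runs.
    twist-coefficients : L.Carrier → Sum → Sum
    twist-coefficients m = map λ (b , g) → L.twist (m L.⊞ L.D g) b , g

    ⟦twist-coefficients⟧ : ∀ m s x → ⟦ twist-coefficients m s ⟧ x ≡ ⟦ D s ⟧ x + log2 * L.⟦ m ⟧ x * ⟦ s ⟧ x
    ⟦twist-coefficients⟧ m []            x = sym (trans (+-identityˡ _) (zeroʳ _))
    ⟦twist-coefficients⟧ m ((b , g) ∷ s) x = trans
      (cong₂ (λ u v → u * e + v) (trans (L.⟦twist⟧ _ b x) (cong (λ v → L.⟦ L.D b ⟧ x + log2 * v * L.⟦ b ⟧ x) (L.⟦⊞⟧ m (L.D g) x)))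
        (⟦twist-coefficients⟧ m s x))
      (trans
        (solve 8 (λ d c m g b e s′ s → (d :+ c :* (m :+ g) :* b) :* e :+ (s′ :+ c :* m :* s)
            := (d :+ c :* g :* b) :* e :+ s′ :+ c :* m :* (b :* e :+ s)) refl
          (L.⟦ L.D b ⟧ x) log2 (L.⟦ m ⟧ x) (L.⟦ L.D g ⟧ x) (L.⟦ b ⟧ x) e (⟦ D s ⟧ x) (⟦ s ⟧ x))
        (cong (λ u → u * e + ⟦ D s ⟧ x + log2 * L.⟦ m ⟧ x * (L.⟦ b ⟧ x * e + ⟦ s ⟧ x)) (sym (L.⟦twist⟧ (L.D g) b x))))
      where
      e : F
      e = exp (L.⟦ g ⟧ x)

    -- Multiplying by exp (h - g) makes the leading summand (a , g) undergo the reduction of a,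
    -- while the other summands only change their coefficients.
    reducible-∷ : ∀ {a} → Reducible L a → ∀ g s → (∀ s′ → length s′ ≡ length s → Reducible ring s′) →
      Reducible ring ((a , g) ∷ s)
    reducible-∷ (vanishing a≡0) g s ih = equal s
      (λ x → trans (cong (λ u → u * exp (L.⟦ g ⟧ x) + ⟦ s ⟧ x) (a≡0 x)) (trans (cong (_+ ⟦ s ⟧ x) (zeroˡ _)) (+-identityˡ _)))
      (ih s refl)
    reducible-∷ (equal b a≡b r) g s ih = equal ((b , g) ∷ s)
      (λ x → cong (λ u → u * exp (L.⟦ g ⟧ x) + ⟦ s ⟧ x) (a≡b x)) (reducible-∷ r g s ih)
    reducible-∷ {a} (step {h = h} m b th dh b≡ r) g s ih = step
      (embed m-Dg) ((b , g) ∷ twist-coefficients m-Dg s)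
      (isTerm-+ th (isTerm-scale (- 1#) (L.isTerm g)))
      (λ z → subst (HasDerivative _ z) (sym (trans (⟦embed⟧ m-Dg z) (⟦m-Dg⟧ z)))
        (derivative-+ (dh z) (derivative-scale (- 1#) (L.derivative g z))))
      twisted
      -- The remaining coefficients have changed but their number has not, which is why `ih` covers
      -- all sums of the given length.
      (reducible-∷ r g (twist-coefficients m-Dg s) λ s′ e → ih s′ (trans e (length-map _ s)))
      where
      m-Dg : L.Carrier
      m-Dg = m L.⊞ L.const (- 1#) L.⊠ L.D g
      ⟦m-Dg⟧ : ∀ x → L.⟦ m-Dg ⟧ x ≡ L.⟦ m ⟧ x + - 1# * L.⟦ L.D g ⟧ x
      ⟦m-Dg⟧ x = trans (L.⟦⊞⟧ _ _ x) (cong (L.⟦ m ⟧ x +_) (trans (L.⟦⊠⟧ _ _ x) (cong (_* L.⟦ L.D g ⟧ x) (L.⟦const⟧ (- 1#) x))))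
      twisted : ∀ x → ⟦ (b , g) ∷ twist-coefficients m-Dg s ⟧ x ≡ ⟦ twist (embed m-Dg) ((a , g) ∷ s) ⟧ x
      twisted x = trans
        (cong₂ (λ u v → u * e + v) (trans (b≡ x) (L.⟦twist⟧ m a x))
          (trans (⟦twist-coefficients⟧ m-Dg s x) (cong (λ v → ⟦ D s ⟧ x + log2 * v * ⟦ s ⟧ x) (⟦m-Dg⟧ x))))
        (trans
          (solve 8 (λ a′ c m a e s′ g s → (a′ :+ c :* m :* a) :* e :+ (s′ :+ c :* (m :+ :- con (pos 1) :* g) :* s)
              := (a′ :+ c :* g :* a) :* e :+ s′ :+ c :* (m :+ :- con (pos 1) :* g) :* (a :* e :+ s)) refl
            (L.⟦ L.D a ⟧ x) log2 (L.⟦ m ⟧ x) (L.⟦ a ⟧ x) e (⟦ D s ⟧ x) (L.⟦ L.D g ⟧ x) (⟦ s ⟧ x))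
          (sym (trans (⟦twist⟧ (embed m-Dg) ((a , g) ∷ s) x)
            (cong₂ (λ u v → u * e + ⟦ D s ⟧ x + log2 * v * (L.⟦ a ⟧ x * e + ⟦ s ⟧ x))
              (L.⟦twist⟧ (L.D g) a x) (trans (⟦embed⟧ m-Dg x) (⟦m-Dg⟧ x))))))
        where
        e : F
        e = exp (L.⟦ g ⟧ x)

    -- Induction on the number of summands; inside it, `reducible-∷` recurses on the reduction of
    -- the leading coefficient in the lower ring.
    reducible-of-length : ∀ n s → length s ≡ n → Reducible ring s
    reducible-of-length _       []            _    = vanishing (λ _ → refl)
    reducible-of-length (suc n) ((a , g) ∷ s) e    = reducible-∷ (reducibleᴸ a) g s
      λ s′ e′ → reducible-of-length n s′ (trans e′ (ℕₚ.suc-injective e))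

    reducible : ∀ s → Reducible ring s
    reducible s = reducible-of-length _ s refl

  -- The tower of exponential polynomial rings.

  mutual
    tower : ℕ → FunctionRing
    tower zero    = Polynomial.ring
    tower (suc k) = ExponentialSum.ring (tower k) (tower-reducible k)

    tower-reducible : ∀ k a → Reducible (tower k) a
    tower-reducible zero    = Polynomial.reducible
    tower-reducible (suc k) = ExponentialSum.reducible (tower k) (tower-reducible k)

  -- The index k bounds the nesting depth of exp.
  record ExponentialPolynomial (k : ℕ) (f : F → F) : Set where
    constructor represented-by
    field
      element : FunctionRing.Carrier (tower k)
      value   : ∀ x → FunctionRing.⟦_⟧ (tower k) element x ≡ f x

-- From arithmetic terms to exponential polynomials.

module OpenInduction (R : ExpField) (maxVal : MaxVal R)
  (exp1 : ExpField.exp R (ExpField.1# R) ≡ ExpField._+_ R (ExpField.1# R) (ExpField.1# R)) where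
  open import Data.List using () renaming (_∷_ to _∷ᴸ_; [] to []ᴸ)
  open import Data.Vec.Functional using (_∷_)
  open ExponentialPolynomials R maxVal exp1

  lift : ∀ {k f} j → ExponentialPolynomial k f → ExponentialPolynomial (j ℕ.+ k) f
  lift zero    p = p
  lift {k} (suc j) p with lift j p
  ... | represented-by a e = represented-by (ExponentialSum.embed (tower (j ℕ.+ k)) (tower-reducible (j ℕ.+ k)) a)
    λ x → trans (ExponentialSum.⟦embed⟧ (tower (j ℕ.+ k)) (tower-reducible (j ℕ.+ k)) a x) (e x)

  common-level : ∀ {k l f g} → ExponentialPolynomial k f → ExponentialPolynomial l g →
    ∃ λ m → ExponentialPolynomial m f × ExponentialPolynomial m g
  common-level {k} {l} {f} p q = k ℕ.+ l , subst (λ m → ExponentialPolynomial m f) (ℕₚ.+-comm l k) (lift l p) , lift k q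

  module _ {k : ℕ} where
    open FunctionRing (tower k) using (const; _⊞_; _⊠_; ⟦const⟧; ⟦⊞⟧; ⟦⊠⟧) 

    ep-const : ∀ c → ExponentialPolynomial k (λ _ → c)
    ep-const c = represented-by (const c) (⟦const⟧ c)

    ep-+ : ∀ {f g} → ExponentialPolynomial k f → ExponentialPolynomial k g → ExponentialPolynomial k (λ x → f x + g x)
    ep-+ (represented-by a e) (represented-by b e′) = represented-by (a ⊞ b) λ x → trans (⟦⊞⟧ a b x) (cong₂ _+_ (e x) (e′ x))

    ep-* : ∀ {f g} → ExponentialPolynomial k f → ExponentialPolynomial k g → ExponentialPolynomial k (λ x → f x * g x)
    ep-* (represented-by a e) (represented-by b e′) = represented-by (a ⊠ b) λ x → trans (⟦⊠⟧ a b x) (cong₂ _*_ (e x) (e′ x))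

    ep-exp : ∀ {f} → ExponentialPolynomial k f → ExponentialPolynomial (suc k) (λ x → exp (f x))
    ep-exp (represented-by a e) = represented-by (ExponentialSum.exponential (tower k) (tower-reducible k) a)
      λ x → trans (ExponentialSum.⟦exponential⟧ (tower k) (tower-reducible k) a x) (cong exp (e x))

  ep-id : ExponentialPolynomial 0 (λ x → x)
  ep-id = represented-by (0# ∷ᴸ 1# ∷ᴸ []ᴸ) (solve 1 (λ x → con (pos 0) :+ x :* (con (pos 1) :+ x :* con (pos 0)) := x) refl)

  ep-sign : ∀ {k f} → ExponentialPolynomial k f → FinitelyManySignChanges f
  ep-sign {k} (represented-by a e) p q = piecewise-map
    (constantSign-scale (λ _ → 1#) (λ _ → 0<1) (λ x → trans (sym (e x)) (sym (*-identityˡ _))))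
    (reducible-sign (tower k) (tower-reducible k a) p q)

  -- Formulas are interpreted in all of F, because sign changes may occur at points outside `M`.
  evalF : ∀ {n} → ATerm n → (Fin n → F) → F
  evalF (var i)  ρ = ρ i
  evalF 𝟘        ρ = 0#
  evalF (𝑆 t)    ρ = evalF t ρ + 1#
  evalF (t ⊕ s)  ρ = evalF t ρ + evalF s ρ
  evalF (t ⊗ s)  ρ = evalF t ρ * evalF s ρ
  evalF (exp' t) ρ = exp (evalF t ρ)

  SatF : ∀ {n} → QF n → (Fin n → F) → Set
  SatF (t ≐ s)  ρ = evalF t ρ ≡ evalF s ρ
  SatF (t ≼ s)  ρ = evalF t ρ ≤ evalF s ρ
  SatF (¬' φ)   ρ = ¬ SatF φ ρ
  SatF (φ ∧' ψ) ρ = SatF φ ρ × SatF ψ ρ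
  SatF (φ ∨' ψ) ρ = SatF φ ρ ⊎ SatF ψ ρ
  SatF (φ ⇒' ψ) ρ = SatF φ ρ → SatF ψ ρ

  evalF-ep : ∀ {n} (t : ATerm (suc n)) (ys : Fin n → F) → ∃ λ k → ExponentialPolynomial k (λ z → evalF t (z ∷ ys))
  evalF-ep (var zero)    ys = 0 , ep-id
  evalF-ep (var (suc i)) ys = 0 , ep-const (ys i)
  evalF-ep 𝟘             ys = 0 , ep-const 0#
  evalF-ep (𝑆 t)         ys with evalF-ep t ys
  ... | k , p = k , ep-+ p (ep-const 1#)
  evalF-ep (t ⊕ s)       ys with evalF-ep t ys | evalF-ep s ys
  ... | _ , p | _ , q with common-level p q
  ... | m , p′ , q′ = m , ep-+ p′ q′
  evalF-ep (t ⊗ s)       ys with evalF-ep t ys | evalF-ep s ys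
  ... | _ , p | _ , q with common-level p q
  ... | m , p′ , q′ = m , ep-* p′ q′
  evalF-ep (exp' t)      ys with evalF-ep t ys
  ... | k , p = suc k , ep-exp p

  -- Finitely many truth changes of quantifier-free formulas.

  difference-sign : ∀ {n} (t s : ATerm (suc n)) (ys : Fin n → F) →
    FinitelyManySignChanges (λ z → evalF t (z ∷ ys) + - 1# * evalF s (z ∷ ys))
  difference-sign t s ys with evalF-ep t ys | evalF-ep s ys
  ... | _ , p | _ , q with common-level p q
  ... | m , p′ , q′ = ep-sign (ep-+ p′ (ep-* (ep-const (- 1#)) q′))

  -- Each piece carries a decision valid on all of it, so negation and implication can be treated
  -- constructively.
  ConstantTruth : (F → Set) → F → F → Set
  ConstantTruth P p q = (∀ z → p < z → z < q → P z) ⊎ (∀ z → p < z → z < q → ¬ P z)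

  FinitelyManyTruthChanges : (F → Set) → Set
  FinitelyManyTruthChanges P = ∀ p q → Piecewise (ConstantTruth P) p q

  constantTruth-restrict : ∀ {P p q p′ q′} → p ≤ p′ → q′ ≤ q → ConstantTruth P p q → ConstantTruth P p′ q′
  constantTruth-restrict p≤p′ q′≤q (inj₁ h) = inj₁ λ z a b → h z (≤-<-trans p≤p′ a) (<-≤-trans b q′≤q)
  constantTruth-restrict p≤p′ q′≤q (inj₂ h) = inj₂ λ z a b → h z (≤-<-trans p≤p′ a) (<-≤-trans b q′≤q)

  module _ {P Q S : F → Set}
    (combine : ∀ {p q} → ConstantTruth P p q → ConstantTruth Q p q → ConstantTruth S p q) where

    -- A break point of the second partition inside (p , q) cuts the interval. If it lies outside,
    -- (p , q) is contained in one half and the other half is discarded.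
    refine-piece : ∀ {p q p′ q′} → p′ ≤ p → q ≤ q′ → ConstantTruth P p q → Piecewise (ConstantTruth Q) p′ q′ →
      Piecewise (ConstantTruth S) p q
    refine-piece p′≤p q≤q′ c (piece d) = piece (combine c (constantTruth-restrict p′≤p q≤q′ d))
    refine-piece {p} {q} p′≤p q≤q′ c (split r a b) with <-≤-connex p r | <-≤-connex r q
    ... | inj₂ r≤p | _        = refine-piece r≤p q≤q′ c b
    ... | inj₁ _   | inj₂ q≤r = refine-piece p′≤p q≤r c a
    ... | inj₁ p<r | inj₁ r<q = split r
      (refine-piece p′≤p ≤-refl (constantTruth-restrict ≤-refl (inj₁ r<q) c) a)
      (refine-piece ≤-refl q≤q′ (constantTruth-restrict (inj₁ p<r) ≤-refl c) b)

    truthChanges-combine : FinitelyManyTruthChanges P → FinitelyManyTruthChanges Q → FinitelyManyTruthChanges S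
    truthChanges-combine P-changes Q-changes p q =
      piecewise-bind (λ {p} {q} c → refine-piece ≤-refl ≤-refl c (Q-changes p q)) (P-changes p q)

  satF-truthChanges : ∀ {n} (φ : QF (suc n)) (ys : Fin n → F) → FinitelyManyTruthChanges (λ z → SatF φ (z ∷ ys))
  satF-truthChanges (t ≐ s) ys p q = piecewise-map truth (difference-sign t s ys p q)
    where
    f g : F → F
    f z = evalF t (z ∷ ys)
    g z = evalF s (z ∷ ys)
    difference : ∀ z → f z ≡ g z → f z + - 1# * g z ≡ 0#
    difference z e = trans (cong (_+ - 1# * g z) e) (solve 1 (λ a → a :+ :- con (pos 1) :* a := con (pos 0)) refl (g z))
    truth : ∀ {p q} → ConstantSign (λ z → f z + - 1# * g z) p q → ConstantTruth (λ z → f z ≡ g z) p q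
    truth (inj₁ h)        = inj₂ λ z a b e → <-irrefl (difference z e) (h z a b)
    truth (inj₂ (inj₁ h)) = inj₁ λ z a b → x-y≡0⇒x≡y
      (trans (solve 2 (λ f g → f :- g := f :+ :- con (pos 1) :* g) refl (f z) (g z)) (h z a b))
    truth (inj₂ (inj₂ h)) = inj₂ λ z a b e → <-irrefl (sym (difference z e)) (h z a b)
  satF-truthChanges (t ≼ s) ys p q = piecewise-map truth (difference-sign t s ys p q)
    where
    f g : F → F
    f z = evalF t (z ∷ ys)
    g z = evalF s (z ∷ ys)
    truth : ∀ {p q} → ConstantSign (λ z → f z + - 1# * g z) p q → ConstantTruth (λ z → f z ≤ g z) p q
    truth (inj₁ h) = inj₁ λ z a b → inj₁ (0<y-x⇒x<y
      (subst (0# <_) (solve 2 (λ f g → :- (f :+ :- con (pos 1) :* g) := g :- f) refl (f z) (g z)) (x<0⇒0<-x (h z a b))))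
    truth (inj₂ (inj₁ h)) = inj₁ λ z a b → inj₂ (x-y≡0⇒x≡y
      (trans (solve 2 (λ f g → f :- g := f :+ :- con (pos 1) :* g) refl (f z) (g z)) (h z a b)))
    truth (inj₂ (inj₂ h)) = inj₂ λ z a b → <⇒≱ (0<y-x⇒x<y
      (subst (0# <_) (solve 2 (λ f g → f :+ :- con (pos 1) :* g := f :- g) refl (f z) (g z)) (h z a b)))
  satF-truthChanges (¬' φ) ys p q = piecewise-map
    [ (λ h → inj₂ λ z a b n → n (h z a b)) , inj₁ ] (satF-truthChanges φ ys p q)
  satF-truthChanges (φ ∧' ψ) ys = truthChanges-combine combine (satF-truthChanges φ ys) (satF-truthChanges ψ ys)
    where
    combine : ∀ {p q} → _ → _ → ConstantTruth (λ z → SatF (φ ∧' ψ) (z ∷ ys)) p q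
    combine (inj₁ h) (inj₁ h′) = inj₁ λ z a b → h z a b , h′ z a b
    combine (inj₂ h) _         = inj₂ λ z a b s → h z a b (proj₁ s)
    combine (inj₁ _) (inj₂ h′) = inj₂ λ z a b s → h′ z a b (proj₂ s)
  satF-truthChanges (φ ∨' ψ) ys = truthChanges-combine combine (satF-truthChanges φ ys) (satF-truthChanges ψ ys)
    where
    combine : ∀ {p q} → _ → _ → ConstantTruth (λ z → SatF (φ ∨' ψ) (z ∷ ys)) p q
    combine (inj₁ h) _         = inj₁ λ z a b → inj₁ (h z a b)
    combine (inj₂ _) (inj₁ h′) = inj₁ λ z a b → inj₂ (h′ z a b)
    combine (inj₂ h) (inj₂ h′) = inj₂ λ z a b → [ h z a b , h′ z a b ]
  satF-truthChanges (φ ⇒' ψ) ys = truthChanges-combine combine (satF-truthChanges φ ys) (satF-truthChanges ψ ys)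
    where
    combine : ∀ {p q} → _ → _ → ConstantTruth (λ z → SatF (φ ⇒' ψ) (z ∷ ys)) p q
    combine (inj₂ h) _         = inj₁ λ z a b s → ⊥-elim (h z a b s)
    combine (inj₁ _) (inj₁ h′) = inj₁ λ z a b _ → h′ z a b
    combine (inj₁ h) (inj₂ h′) = inj₂ λ z a b s → h′ z a b (s (h z a b))

  -- Open induction along the integer part.

  module _ (M : F → Set) (IP : ExpIntegerPart R M) where
    open ExpIntegerPart IP

    M-difference : ∀ {x y} → M x → M y → M (y - x)
    M-difference Mx My = M-+ _ _ My (M-- _ Mx)

    <⇒+1≤ : ∀ {x y} → M x → M y → x < y → x + 1# ≤ y
    <⇒+1≤ {x} {y} Mx My x<y = ≤-from-difference _ (x≤y⇒0≤y-x (discrete _ (M-difference Mx My) (x<y⇒0<y-x x<y)))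
      (solve 2 (λ x y → x :+ con (pos 1) :+ (y :- x :- con (pos 1)) := y) refl x y)

    predecessor : ∀ {m} → M m → 0# ≤ m → m ≡ 0# ⊎ ∃ λ k → M k × 0# ≤ k × k + 1# ≡ m
    predecessor Mm (inj₂ 0≡m) = inj₁ (sym 0≡m)
    predecessor {m} Mm (inj₁ 0<m) = inj₂ (m - 1# , M-difference M-1 Mm , x≤y⇒0≤y-x (discrete m Mm 0<m) ,
      solve 1 (λ m → m :- con (pos 1) :+ con (pos 1) := m) refl m)

    module _ {P : F → Set} (base : P 0#) (succ : ∀ m → M m → 0# ≤ m → P m → P (m + 1#)) where

      HoldsUpTo : F → Set
      HoldsUpTo p = ∀ m → M m → 0# ≤ m → m ≤ p → P m

      -- If P failed on all of (p , q), it would fail at ⌊p⌋ + 1 although it holds at ⌊p⌋.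
      no-failure-piece : ∀ {p q m} → HoldsUpTo p → (∀ z → p < z → z < q → ¬ P z) → M m → 0# ≤ m → p < m → m < q → ⊥
      no-failure-piece {p} {q} {m} upto fails Mm 0≤m p<m m<q with <-≤-connex p 0# | integerPart p
      -- The floor of a negative `p` is not in the range of the induction, but here 0 itself lies in
      -- (p , q) and `base` applies.
      ... | inj₁ p<0 | _ = fails 0# p<0 (≤-<-trans 0≤m m<q) base
      ... | inj₂ 0≤p | k , Mk , k≤p , p<k+1 =
        fails (k + 1#) p<k+1 (≤-<-trans (<⇒+1≤ Mk Mm (≤-<-trans k≤p p<m)) m<q) (succ k Mk 0≤k (upto k Mk 0≤k k≤p))
        where
        0≤k : 0# ≤ k
        0≤k with <-≤-connex k 0#
        ... | inj₂ 0≤k = 0≤k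
        -- A negative k would satisfy k + 1 ≤ 0 ≤ p, against p < k + 1.
        ... | inj₁ k<0 = ⊥-elim (<⇒≱ (≤-<-trans 0≤p p<k+1) (<⇒+1≤ Mk M-0 k<0))

      -- A nonzero m ≤ q has a predecessor k < q, which is either at most `p` or strictly inside the
      -- piece. So `P` at the break point `q` itself comes from the induction step and not from the
      -- constant truth value.
      holdsUpTo-piece : ∀ {p q} → ConstantTruth P p q → HoldsUpTo p → HoldsUpTo q
      holdsUpTo-piece {p} {q} c upto m Mm 0≤m m≤q with predecessor Mm 0≤m
      ... | inj₁ refl = base
      ... | inj₂ (k , Mk , 0≤k , refl) = succ k Mk 0≤k (below (<-≤-connex p k) c)
        where
        k<q : k < q
        k<q = <-≤-trans (pos⇒x<x+y 0<1) m≤q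
        below : p < k ⊎ k ≤ p → ConstantTruth P p q → P k
        below (inj₂ k≤p) _            = upto k Mk 0≤k k≤p
        below (inj₁ p<k) (inj₁ holds) = holds k p<k k<q
        below (inj₁ p<k) (inj₂ fails) = ⊥-elim (no-failure-piece upto fails Mk 0≤k p<k k<q)

      holdsUpTo-piecewise : ∀ {p q} → Piecewise (ConstantTruth P) p q → HoldsUpTo p → HoldsUpTo q
      holdsUpTo-piecewise (piece c)     upto = holdsUpTo-piece c upto
      holdsUpTo-piecewise (split r a b) upto = holdsUpTo-piecewise b (holdsUpTo-piecewise a upto)

      -- Only the interval from 0 to the target m is partitioned; at its left end the claim is
      -- `base`.
      induction : FinitelyManyTruthChanges P → ∀ m → M m → 0# ≤ m → P m
      induction changes m Mm 0≤m = holdsUpTo-piecewise (changes 0# m)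
        (λ k Mk 0≤k k≤0 → subst P (≤-antisym 0≤k k≤0) base) m Mm 0≤m ≤-refl

    -- Transfer to the nonnegative part and verification of the axioms.

    𝔐 : AStructure
    𝔐 = M⁺-structure R M IP

    evalA-evalF : ∀ {n} (t : ATerm n) {ρ : Fin n → AStructure.A 𝔐} {ρ′ : Fin n → F} → (∀ i → proj₁ (ρ i) ≡ ρ′ i) →
      proj₁ (evalA 𝔐 t ρ) ≡ evalF t ρ′
    evalA-evalF (var i)  e = e i
    evalA-evalF 𝟘        e = refl
    evalA-evalF (𝑆 t)    e = cong (_+ 1#) (evalA-evalF t e)
    evalA-evalF (t ⊕ s)  e = cong₂ _+_ (evalA-evalF t e) (evalA-evalF s e)
    evalA-evalF (t ⊗ s)  e = cong₂ _*_ (evalA-evalF t e) (evalA-evalF s e)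
    evalA-evalF (exp' t) e = cong exp (evalA-evalF t e)

    module _ {n : ℕ} {ρ : Fin n → AStructure.A 𝔐} {ρ′ : Fin n → F} (e : ∀ i → proj₁ (ρ i) ≡ ρ′ i) where
      mutual
        -- Negation and implication reverse the direction, hence the simultaneous recursion with the
        -- converse. Environments are related pointwise, which is all that evaluation uses.
        Sat⇒SatF : ∀ φ → Sat 𝔐 φ ρ → SatF φ ρ′
        Sat⇒SatF (t ≐ s)  h        = trans (sym (evalA-evalF t e)) (trans h (evalA-evalF s e))
        Sat⇒SatF (t ≼ s)  h        = subst₂ _≤_ (evalA-evalF t e) (evalA-evalF s e) h
        Sat⇒SatF (¬' φ)   h        = λ h′ → h (SatF⇒Sat φ h′)
        Sat⇒SatF (φ ∧' ψ) (h , h′) = Sat⇒SatF φ h , Sat⇒SatF ψ h′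
        Sat⇒SatF (φ ∨' ψ) (inj₁ h) = inj₁ (Sat⇒SatF φ h)
        Sat⇒SatF (φ ∨' ψ) (inj₂ h) = inj₂ (Sat⇒SatF ψ h)
        Sat⇒SatF (φ ⇒' ψ) h        = λ h′ → Sat⇒SatF ψ (h (SatF⇒Sat φ h′))

        SatF⇒Sat : ∀ φ → SatF φ ρ′ → Sat 𝔐 φ ρ
        SatF⇒Sat (t ≐ s)  h        = trans (evalA-evalF t e) (trans h (sym (evalA-evalF s e)))
        SatF⇒Sat (t ≼ s)  h        = subst₂ _≤_ (sym (evalA-evalF t e)) (sym (evalA-evalF s e)) h
        SatF⇒Sat (¬' φ)   h        = λ h′ → h (Sat⇒SatF φ h′)
        SatF⇒Sat (φ ∧' ψ) (h , h′) = SatF⇒Sat φ h , SatF⇒Sat ψ h′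
        SatF⇒Sat (φ ∨' ψ) (inj₁ h) = inj₁ (SatF⇒Sat φ h)
        SatF⇒Sat (φ ∨' ψ) (inj₂ h) = inj₂ (SatF⇒Sat ψ h)
        SatF⇒Sat (φ ⇒' ψ) h        = λ h′ → SatF⇒Sat ψ (h (Sat⇒SatF φ h′))

    open-induction : ∀ n (φ : QF (suc n)) (ys : Fin n → AStructure.A 𝔐) →
      Sat 𝔐 φ (AStructure.zero 𝔐 ∷ ys) → (∀ x → Sat 𝔐 φ (x ∷ ys) → Sat 𝔐 φ (AStructure.S 𝔐 x ∷ ys)) →
      ∀ x → Sat 𝔐 φ (x ∷ ys)
    open-induction n φ ys base succ (m , Mm , 0≤m) = SatF⇒Sat values φ (induction
      (Sat⇒SatF values φ base)
      (λ k Mk 0≤k h → Sat⇒SatF values φ (succ (k , Mk , 0≤k) (SatF⇒Sat values φ h)))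
      (satF-truthChanges φ (λ i → proj₁ (ys i))) m Mm 0≤m)
      where
      values : ∀ {x} i → proj₁ ((x ∷ ys) i) ≡ (proj₁ x ∷ (λ i → proj₁ (ys i))) i
      values zero    = refl
      values (suc i) = refl

    model : ModelOfIOpenExp 𝔐
    model = record
      { Q1 = λ (x , _ , 0≤x) e → <-irrefl (sym e) (≤-<-trans 0≤x (pos⇒x<x+y 0<1))
      ; Q2 = λ (x , _) (y , _) e → trans (solve 1 (λ x → x := x :+ con (pos 1) :- con (pos 1)) refl x)
          (trans (cong (_- 1#) e) (solve 1 (λ y → y :+ con (pos 1) :- con (pos 1) := y) refl y))
      ; Q3 = λ (x , Mx , 0≤x) x≢0 → [ (λ x≡0 → ⊥-elim (x≢0 x≡0)) , (λ (k , Mk , 0≤k , e) → (k , Mk , 0≤k) , sym e) ]′ (predecessor Mx 0≤x)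
      ; Q4 = λ (x , _) → +-identityʳ x
      ; Q5 = λ (x , _) (y , _) → sym (+-assoc x y 1#)
      ; Q6 = λ (x , _) → zeroʳ x
      ; Q7 = λ (x , _) (y , _) → solve 2 (λ x y → x :* (y :+ con (pos 1)) := x :* y :+ x) refl x y
      ; Q8 = λ (x , Mx , _) (y , My , _) →
          (λ x≤y → (y - x , M-difference Mx My , x≤y⇒0≤y-x x≤y) , solve 2 (λ x y → y :- x :+ x := y) refl x y) ,
          (λ ((r , _ , 0≤r) , e) → ≤-from-difference r 0≤r (trans (+-comm x r) e))
      ; E1 = trans exp-zero (sym (+-identityˡ 1#))
      ; E2 = λ (x , _) → trans (exp-hom x 1#) (trans (cong (exp x *_) exp1)
          (solve 1 (λ a → a :* con (pos 2) := a :+ a) refl (exp x)))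
      ; IOpen = open-induction
      }

theorem2p5 : (R : ExpField) → MaxVal R →
    ExpField.exp R (ExpField.1# R) ≡ ExpField._+_ R (ExpField.1# R) (ExpField.1# R) →
    (M : ExpField.F R → Set) → (IP : ExpIntegerPart R M) →
    ModelOfIOpenExp (M⁺-structure R M IP)
theorem2p5 R maxVal exp1 M IP = OpenInduction.model R maxVal exp1 M IP
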